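{- Let $\mathcal{P}\subseteq2^\omega$ be a nonempty $\Pi^0_1$ class. Then $X\in\mathcal{P}$ is a randomly produced path through $T_{\mathcal{P}}$ if and only if there is a constant $c$ such that for all $n$, $$K^{T_{\mathcal{P}}}(X\upharpoonright n)\ge\theta_{\mathcal{P}}(X\upharpoonright n)-c.$$
   Context: Notation: $2^\omega$ is the set of infinite binary sequences, $2^{<\omega}$ the set of finite binary strings, $|\sigma|$ the length of $\sigma$, $X\upharpoonright n$ (or $\sigma\upharpoonright n$) the initial segment of length $n$, $[\![\sigma]\!]=\{X\in2^\omega:\sigma\prec X\}$. For nonempty $\sigma$, $\sigma^{\curvearrowright}$ is the string obtained by flipping the last bit of $\sigma$. A $\Pi^0_1$ class is the set of infinite paths through a computable tree $T\subseteq2^{<\omega}$. For a closed set $\mathcal{P}$, $T_{\mathcal{P}}=\{\sigma:\mathcal{P}\cap[\![\sigma]\!]\neq\emptyset\}$. $K^A$ is prefix-free Kolmogorov complexity relative to the oracle $A$. $\mathsf{MLR}^A$ is the set of sequences that are Martin-Löf random relative to $A$ with respect to Lebesgue measure. $\theta_{\mathcal{P}}(\sigma)=\#\{n:1\le n\le|\sigma|\ \&\ (\sigma\upharpoonright n)^{\curvearrowright}\in T_{\mathcal{P}}\}$. Randomly produced paths: for $R\in2^\omega$, $\Psi_{\mathcal{P}}(R)\in\mathcal{P}$ is the sequence $X$ built recursively as follows. Given $\sigma=X\upharpoonright m\in T_{\mathcal{P}}$, let $n$ be the number of bits of $R$ used so far, i.e. the number of $j<m$ such that both one-bit extensions of $X\upharpoonright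 j$ lie in $T_{\mathcal{P}}$. If only one $i\in\{0,1\}$ satisfies $\sigma i\in T_{\mathcal{P}}$, put $X(m)=i$; if both $\sigma0,\sigma1\in T_{\mathcal{P}}$, put $X(m)=R(n)$. The randomly produced paths through $T_{\mathcal{P}}$ are the members of $\{\Psi_{\mathcal{P}}(R):R\in\mathsf{MLR}^{T_{\mathcal{P}}}\}$. -}

module Defs where

open import Axiom.ExcludedMiddle using (ExcludedMiddle)
open import Data.Bool.Base using (Bool; true; false; not; if_then_else_)
open import Data.Fin.Base using (Fin)
open import Data.List.Base
  using (List; []; _∷_; _∷ʳ_; length; take; filter; upTo; applyUpTo)
open import Data.List.Relation.Binary.Prefix.Heterogeneous using (Prefix)
open import Data.List.Relation.Unary.All using (All)
open import Data.List.Relation.Unary.Unique.Propositional using (Unique)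
open import Data.Nat.Base using (ℕ; zero; suc; _+_; _*_; _^_; _≤_; _<_)
open import Data.Product.Base using (_×_; ∃; ∃-syntax)
open import Data.Sum.Base using (_⊎_)
open import Data.Vec.Base as Vec using (Vec; []; _∷_)
open import Data.Vec.Relation.Binary.Pointwise.Inductive using (Pointwise)
open import Function.Bundles using (_⇔_)
open import Level using (0ℓ)
open import Relation.Binary.PropositionalEquality.Core using (_≡_; _≗_)
open import Relation.Nullary.Decidable.Core using (Dec; yes; no; does; _×-dec_)
open import Relation.Nullary.Negation.Core using (¬_)
open import Relation.Unary using (Pred; Decidable; _∈_)

------------------------------------------------------------------------
-- Strings and sequences

String : Set
String = List Bool

Seq : Set
Seq = ℕ → Bool

infix 8 _↾_

_↾_ : Seq → ℕ → String
X ↾ n = applyUpTo X n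

infix 4 _≼_ _≺_

_≼_ : String → String → Set
_≼_ = Prefix _≡_

_≺_ : String → Seq → Set
σ ≺ X = X ↾ length σ ≡ σ

-- Only used on nonempty strings.
flipLast : String → String
flipLast []          = []
flipLast (b ∷ [])    = not b ∷ []
flipLast (b ∷ c ∷ σ) = b ∷ flipLast (c ∷ σ)

-- The bijection between strings and numbers given by bijective base 2,
-- least significant digit first (false is the digit 1, true the digit 2).
-- `next` is the successor under this identification.
enc : String → ℕ
enc []          = 0
enc (false ∷ σ) = 1 + 2 * enc σ
enc (true  ∷ σ) = 2 + 2 * enc σ

next : String → String
next []          = false ∷ []
next (false ∷ σ) = true ∷ σ
next (true  ∷ σ) = false ∷ next σ

dec : ℕ → String
dec zero    = []
dec (suc n) = next (dec n)

------------------------------------------------------------------------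
-- Partial recursive functions relative to an oracle

-- An oracle is a set of numbers, given by its characteristic function.
Oracle : Set
Oracle = ℕ → Bool

∅ₒ : Oracle
∅ₒ _ = false

χ : {S : Pred String 0ℓ} → Decidable S → Oracle
χ S? n = does (S? (dec n))

data Code : ℕ → Set where
  zeroᶜ   : ∀ {n} → Code n
  sucᶜ    : Code 1
  projᶜ   : ∀ {n} → Fin n → Code n
  oracleᶜ : Code 1
  compᶜ   : ∀ {m n} → Code m → Vec (Code n) m → Code n
  recᶜ    : ∀ {n} → Code n → Code (2 + n) → Code (suc n)
  muᶜ     : ∀ {n} → Code (suc n) → Code n

infix 4 _⊢_⟨_⟩⇓_

data _⊢_⟨_⟩⇓_ (A : Oracle) : ∀ {n} → Code n → Vec ℕ n → ℕ → Set where
  ⇓zero   : ∀ {n} {xs : Vec ℕ n} → A ⊢ zeroᶜ ⟨ xs ⟩⇓ 0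
  ⇓suc    : ∀ {x} → A ⊢ sucᶜ ⟨ x ∷ [] ⟩⇓ suc x
  ⇓proj   : ∀ {n} {i : Fin n} {xs} → A ⊢ projᶜ i ⟨ xs ⟩⇓ Vec.lookup xs i
  ⇓oracle : ∀ {x} → A ⊢ oracleᶜ ⟨ x ∷ [] ⟩⇓ (if A x then 1 else 0)
  ⇓comp   : ∀ {m n} {f : Code m} {gs : Vec (Code n) m} {xs ys z} →
            Pointwise (λ g y → A ⊢ g ⟨ xs ⟩⇓ y) gs ys →
            A ⊢ f ⟨ ys ⟩⇓ z → A ⊢ compᶜ f gs ⟨ xs ⟩⇓ z
  ⇓rec0   : ∀ {n} {f : Code n} {g xs y} →
            A ⊢ f ⟨ xs ⟩⇓ y → A ⊢ recᶜ f g ⟨ 0 ∷ xs ⟩⇓ y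
  ⇓rec+   : ∀ {n} {f : Code n} {g k xs y z} →
            A ⊢ recᶜ f g ⟨ k ∷ xs ⟩⇓ y → A ⊢ g ⟨ k ∷ y ∷ xs ⟩⇓ z →
            A ⊢ recᶜ f g ⟨ suc k ∷ xs ⟩⇓ z
  ⇓mu     : ∀ {n} {f : Code (suc n)} {xs y} →
            A ⊢ f ⟨ y ∷ xs ⟩⇓ 0 →
            (∀ z → z < y → ∃[ k ] A ⊢ f ⟨ z ∷ xs ⟩⇓ suc k) →
            A ⊢ muᶜ f ⟨ xs ⟩⇓ y

ComputableSet : Pred String 0ℓ → Set
ComputableSet S = ∃[ e ] ∀ σ →
    (S σ × ∅ₒ ⊢ e ⟨ enc σ ∷ [] ⟩⇓ 1)
  ⊎ (¬ S σ × ∅ₒ ⊢ e ⟨ enc σ ∷ [] ⟩⇓ 0)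

------------------------------------------------------------------------
-- Prefix-free complexity

_∈dom[_,_] : String → Oracle → Code 1 → Set
p ∈dom[ A , M ] = ∃[ y ] A ⊢ M ⟨ enc p ∷ [] ⟩⇓ y

_⊢_⟦_⟧≡_ : Oracle → Code 1 → String → String → Set
A ⊢ M ⟦ p ⟧≡ σ = A ⊢ M ⟨ enc p ∷ [] ⟩⇓ enc σ

PrefixFree : Oracle → Code 1 → Set
PrefixFree A M =
  ∀ p q → p ∈dom[ A , M ] → q ∈dom[ A , M ] → p ≼ q → p ≡ q

-- Optimality: U simulates every prefix-free machine with oracle A up to an
-- additive constant in program length.
Optimal : Oracle → Code 1 → Set
Optimal A U = PrefixFree A U ×
  (∀ M → PrefixFree A M → ∃[ c ] ∀ p σ → A ⊢ M ⟦ p ⟧≡ σ →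
    ∃[ q ] (A ⊢ U ⟦ q ⟧≡ σ × length q ≤ length p + c))

-- The prefix-free complexity of σ relative to A, as measured by the
-- machine U, is k.
K[_,_]_≡_ : Oracle → Code 1 → String → ℕ → Set
K[ A , U ] σ ≡ k =
    (∃[ p ] (A ⊢ U ⟦ p ⟧≡ σ × length p ≡ k))
  × (∀ p → A ⊢ U ⟦ p ⟧≡ σ → k ≤ length p)

------------------------------------------------------------------------
-- Martin-Löf randomness

-- Membership of a sequence in the open set generated by W.
_∈⟦_⟧ : Seq → Pred String 0ℓ → Set
X ∈⟦ W ⟧ = ∃[ σ ] (σ ≺ X × W σ)

-- The Lebesgue measure of ⟦ W ⟧ is at most 2 ^ (- n).  The open set ⟦ W ⟧ is
-- the increasing union over N of the clopen sets generated by the strings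
-- of length N that extend a member of W, so its measure is the supremum of
-- (number of such strings) / 2 ^ N.
Measure_≤2^-_ : Pred String 0ℓ → ℕ → Set
Measure W ≤2^- n = ∀ N (F : List String) → Unique F →
  All (λ τ → length τ ≡ N × ∃[ σ ] (W σ × σ ≼ τ)) F →
  length F * 2 ^ n ≤ 2 ^ N

-- The uniformly A-c.e. sequence of sets of strings with index e.
W[_,_] : Oracle → Code 2 → ℕ → Pred String 0ℓ
W[ A , e ] n σ = ∃[ y ] A ⊢ e ⟨ n ∷ enc σ ∷ [] ⟩⇓ y

MLTest : Oracle → Code 2 → Set
MLTest A e = ∀ n → Measure W[ A , e ] n ≤2^- n

MLR : Oracle → Pred Seq 0ℓ
MLR A X = ∀ e → MLTest A e → ¬ (∀ n → X ∈⟦ W[ A , e ] n ⟧)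

------------------------------------------------------------------------
-- Closed sets and their trees

record IsTree (T : Pred String 0ℓ) : Set where
  field prefixClosed : ∀ {σ τ} → σ ≼ τ → T τ → T σ

IsΠ⁰₁ : Pred Seq 0ℓ → Set₁
IsΠ⁰₁ P = ∃[ T ] (IsTree T × ComputableSet T × (∀ X → P X ⇔ (∀ n → T (X ↾ n))))

Tree : Pred Seq 0ℓ → Pred String 0ℓ
Tree P σ = ∃[ X ] (P X × σ ≺ X)

-- Membership in Tree P is not constructively decidable, whereas its use as
-- an oracle, θ and Ψ all rest on case distinctions about it.
tree? : ExcludedMiddle 0ℓ → (P : Pred Seq 0ℓ) → Decidable (Tree P)
tree? em P σ = em

module _ {T : Pred String 0ℓ} (T? : Decidable T) where

  θ : String → ℕ
  θ σ = length (filter (λ n → T? (flipLast (take n σ)))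
                       (applyUpTo suc (length σ)))

  -- The number of proper initial segments of σ at which T branches.
  bitsUsed : String → ℕ
  bitsUsed σ =
    length (filter (λ j → T? (take j σ ∷ʳ false) ×-dec T? (take j σ ∷ʳ true))
                   (upTo (length σ)))

  nextBit : Seq → String → Bool
  nextBit R σ with T? (σ ∷ʳ false) | T? (σ ∷ʳ true)
  ... | yes _ | yes _ = R (bitsUsed σ)
  ... | yes _ | no  _ = false
  ... | no  _ | yes _ = true
  ... | no  _ | no  _ = true  -- impossible when T = Tree P and T σ holds

  Ψ-initial : Seq → ℕ → String
  Ψ-initial R zero    = []
  Ψ-initial R (suc m) = Ψ-initial R m ∷ʳ nextBit R (Ψ-initial R m)

  Ψ : Seq → Seq
  Ψ R m = nextBit R (Ψ-initial R m)

  RandomlyProduced : Pred Seq 0ℓ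
  RandomlyProduced X = ∃[ R ] (R ∈ MLR (χ T?) × Ψ R ≗ X)

{-# OPTIONS --safe #-}

-- Write A for the tree as an oracle. Along a path X the bits at the branching nodes spell out a sequence R with
-- Ψ R = X (or a prefix of many such R, when X branches only finitely often), and θ(X ↾ n) is the number of bits
-- spelt out by X ↾ n. So the theorem is Schnorr's characterisation of randomness, relative to A, transported
-- from R to X.
--
-- If programs of length ≤ θ(X ↾ n) − c for X ↾ n exist for every c, then R lies in the test whose c-th component
-- consists of the branching bits of strings with such short programs; by Kraft's inequality, here a counting
-- argument, it has measure ≤ 2^(−c).
--
-- Conversely, a test covering R is turned into a prefix-free machine: the minimal strings τ of (a decidable
-- version of) its component 2n form a prefix-free set of measure ≤ 2^(−2n), so listing them in order of length
-- and laying their intervals side by side assigns to τ a code of length |τ| − 2n; prefixed with 0^n 1 it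
-- is a program for the strings on the tree whose branching bits are τ, among them an initial segment of X.
--
-- When X branches finitely often R has to be found: an open set of incompressibility failures of measure
-- < 2^(−|ρ|) leaves out some sequence extending ρ.
module Submission where

open import Defs
open import Axiom.ExcludedMiddle using (ExcludedMiddle)
open import Data.Bool.Base using (Bool; true; false; not; _∧_; _∨_; if_then_else_)
import Data.Bool.Properties as Boolₚ
open import Data.Empty using (⊥; ⊥-elim)
open import Data.Fin.Base using (Fin; zero; suc)
open import Data.Fin.Patterns using (0F; 1F; 2F)
open import Data.List.Base
  using (List; []; _∷_; _∷ʳ_; _++_; length; map; take; drop; filter; replicate; applyUpTo; cartesianProduct)
open import Data.List.Properties
open import Data.List.Membership.Propositional using () renaming (_∈_ to _∈ˡ_)
open import Data.List.Membership.Propositional.Properties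
open import Data.List.Relation.Binary.Prefix.Heterogeneous using ([]; _∷_)
import Data.List.Relation.Binary.Prefix.Heterogeneous.Properties as Prefixₚ
open import Data.List.Relation.Unary.All as All using (All; []; _∷_)
open import Data.List.Relation.Unary.AllPairs using ([]; _∷_)
open import Data.List.Relation.Unary.Any using (here; there)
open import Data.List.Relation.Unary.Unique.Propositional using (Unique)
import Data.List.Relation.Unary.Unique.Propositional.Properties as Uniqueₚ
open import Data.Nat.Base
open import Data.Nat.Properties
open import Data.Nat.Tactic.RingSolver using (solve-∀)
open import Data.Product.Base using (_×_; _,_; ∃-syntax; proj₁; proj₂)
open import Data.Sum.Base using (_⊎_; inj₁; inj₂)
open import Data.Unit.Base using (⊤; tt)
open import Data.Vec.Base as Vec using (Vec; []; _∷_)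
import Data.Vec.Properties as Vecₚ
open import Data.Vec.Relation.Binary.Pointwise.Inductive using (Pointwise; []; _∷_)
open import Function.Base using (_∘_; id)
open import Function.Bundles using (_⇔_; mk⇔)
open import Level using (0ℓ)
open import Relation.Binary.Definitions using (tri<; tri≈; tri>)
open import Relation.Binary.PropositionalEquality
open import Relation.Nullary using (¬_; yes; no; does; contradiction)
open import Relation.Nullary.Decidable using (dec-true; dec-false; decidable-stable)
open import Relation.Unary using (Pred; Decidable; Satisfiable; _∈_)

-- The numbering of strings

enc-next : ∀ σ → enc (next σ) ≡ suc (enc σ)
enc-next []          = refl
enc-next (false ∷ σ) = refl
enc-next (true  ∷ σ) = cong suc (trans (cong (2 *_) (enc-next σ)) (*-suc 2 (enc σ)))

enc-dec : ∀ n → enc (dec n) ≡ n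
enc-dec zero    = refl
enc-dec (suc n) = trans (enc-next (dec n)) (cong suc (enc-dec n))

dec-1+2* : ∀ n → dec (1 + 2 * n) ≡ false ∷ dec n
dec-1+2* zero    = refl
dec-1+2* (suc n) = trans (cong (next ∘ dec) (*-suc 2 n)) (cong (next ∘ next) (dec-1+2* n))

dec-enc : ∀ σ → dec (enc σ) ≡ σ
dec-enc []          = refl
dec-enc (false ∷ σ) = trans (dec-1+2* (enc σ)) (cong (false ∷_) (dec-enc σ))
dec-enc (true  ∷ σ) = trans (cong next (dec-1+2* (enc σ))) (cong (true ∷_) (dec-enc σ))

enc-injective : ∀ {σ τ} → enc σ ≡ enc τ → σ ≡ τ
enc-injective {σ} {τ} eq = trans (sym (dec-enc σ)) (trans (cong dec eq) (dec-enc τ))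

-- The strings of length `l` occupy the numbers from `2 ^ l - 1` to `2 ^ (l + 1) - 2`; this is the
-- lower end of that range and `2+enc≤2^` the upper one. Hence running through the numbering lists
-- strings in order of length.
2^length≤1+enc : ∀ σ → 2 ^ length σ ≤ suc (enc σ)
2^length≤1+enc []      = ≤-refl
2^length≤1+enc (b ∷ σ) = begin
  2 * 2 ^ length σ   ≤⟨ *-monoʳ-≤ 2 (2^length≤1+enc σ) ⟩
  2 * suc (enc σ)    ≡⟨ *-suc 2 (enc σ) ⟩
  2 + 2 * enc σ      ≤⟨ step b ⟩
  suc (enc (b ∷ σ))  ∎
  where
  open ≤-Reasoning
  step : ∀ b → 2 + 2 * enc σ ≤ suc (enc (b ∷ σ))
  step false = ≤-refl
  step true  = n≤1+n _

2+enc≤2^ : ∀ σ → 2 + enc σ ≤ 2 ^ suc (length σ)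
2+enc≤2^ []      = ≤-refl
2+enc≤2^ (b ∷ σ) = begin
  2 + enc (b ∷ σ)          ≤⟨ step b ⟩
  2 * 2 + 2 * enc σ        ≡⟨ *-distribˡ-+ 2 2 (enc σ) ⟨
  2 * (2 + enc σ)          ≤⟨ *-monoʳ-≤ 2 (2+enc≤2^ σ) ⟩
  2 * 2 ^ suc (length σ)   ∎
  where
  open ≤-Reasoning
  step : ∀ b → 2 + enc (b ∷ σ) ≤ 4 + 2 * enc σ
  step false = n≤1+n _
  step true  = ≤-refl

enc<⇒length≤ : ∀ σ τ → enc σ < enc τ → length σ ≤ length τ
enc<⇒length≤ σ τ lt with length σ ≤? length τ
... | yes le = le
... | no ¬le = contradiction (begin-strict
  enc τ                    <⟨ n<1+n _ ⟩
  1 + enc τ                <⟨ 2+enc≤2^ τ ⟩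
  2 ^ suc (length τ)       ≤⟨ ^-monoʳ-≤ 2 (≰⇒> ¬le) ⟩
  2 ^ length σ             ≤⟨ 2^length≤1+enc σ ⟩
  suc (enc σ)              ≤⟨ lt ⟩
  enc τ                    ∎) (<-irrefl refl)
  where open ≤-Reasoning

length-dec≤ : ∀ {k} τ → k ≤ enc τ → length (dec k) ≤ length τ
length-dec≤ {k} τ k≤ with m≤n⇒m<n∨m≡n k≤
... | inj₁ lt = enc<⇒length≤ (dec k) τ (subst (_< enc τ) (sym (enc-dec k)) lt)
... | inj₂ eq = ≤-reflexive (cong length (trans (cong dec eq) (dec-enc τ)))

length≤enc : ∀ σ → length σ ≤ enc σ
length≤enc []          = z≤n
length≤enc (false ∷ σ) = s≤s (≤-trans (length≤enc σ) (m≤m+n _ _))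
length≤enc (true  ∷ σ) = s≤s (≤-trans (length≤enc σ) (≤-trans (m≤m+n _ _) (n≤1+n _)))

-- Prefixes

≼-refl : ∀ {σ} → σ ≼ σ
≼-refl {[]}    = []
≼-refl {b ∷ σ} = refl ∷ ≼-refl

≼-trans : ∀ {σ τ υ} → σ ≼ τ → τ ≼ υ → σ ≼ υ
≼-trans = Prefixₚ.trans trans

≼-++ : ∀ σ {ρ} → σ ≼ σ ++ ρ
≼-++ []      = []
≼-++ (b ∷ σ) = refl ∷ ≼-++ σ

≼⇒++ : ∀ {σ τ} → σ ≼ τ → ∃[ ρ ] τ ≡ σ ++ ρ
≼⇒++ []         = _ , refl
≼⇒++ (refl ∷ p) with _ , refl ← ≼⇒++ p = _ , refl

≼∧length≥⇒≡ : ∀ {σ τ} → σ ≼ τ → length τ ≤ length σ → σ ≡ τ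
≼∧length≥⇒≡ {τ = []}    []         _        = refl
≼∧length≥⇒≡ {τ = _ ∷ _} []         ()
≼∧length≥⇒≡             (refl ∷ p) (s≤s le) = cong (_ ∷_) (≼∧length≥⇒≡ p le)

≼-linear : ∀ {σ τ υ} → σ ≼ υ → τ ≼ υ → length σ ≤ length τ → σ ≼ τ
≼-linear []         _          _        = []
≼-linear (refl ∷ p) (refl ∷ q) (s≤s le) = refl ∷ ≼-linear p q le

++-injective : ∀ σ σ′ {τ τ′ : String} → length σ ≡ length σ′ → σ ++ τ ≡ σ′ ++ τ′ → σ ≡ σ′ × τ ≡ τ′
++-injective []      []        _   eq = refl , eq
++-injective (b ∷ σ) (b′ ∷ σ′) len eq
  with refl , eq′ ← ∷-injective eq
  with refl , refl ← ++-injective σ σ′ (suc-injective len) eq′ = refl , refl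

length-↾ : ∀ X n → length (X ↾ n) ≡ n
length-↾ = length-applyUpTo

↾-suc : ∀ X n → X ↾ suc n ≡ X ↾ n ∷ʳ X n
↾-suc X n = sym (applyUpTo-∷ʳ X n)

↾-≺ : ∀ X n → X ↾ n ≺ X
↾-≺ X n = cong (X ↾_) (length-↾ X n)

↾-mono-≼ : ∀ X {m n} → m ≤ n → X ↾ m ≼ X ↾ n
↾-mono-≼ X z≤n      = []
↾-mono-≼ X (s≤s le) = refl ∷ ↾-mono-≼ (X ∘ suc) le

↾-cong-≼ : ∀ X Y {m n} → m ≤ n → X ↾ n ≡ Y ↾ n → X ↾ m ≡ Y ↾ m
↾-cong-≼ X Y z≤n      _  = refl
↾-cong-≼ X Y (s≤s le) eq =
  cong₂ _∷_ (∷-injectiveˡ eq) (↾-cong-≼ (X ∘ suc) (Y ∘ suc) le (∷-injectiveʳ eq))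

≼-≺-trans : ∀ {σ τ X} → σ ≼ τ → τ ≺ X → σ ≺ X
≼-≺-trans             []         _  = refl
≼-≺-trans {X = X} (refl ∷ p) eq =
  cong₂ _∷_ (∷-injectiveˡ eq) (≼-≺-trans {X = X ∘ suc} p (∷-injectiveʳ eq))

≺⇒≼↾ : ∀ {σ} X {n} → σ ≺ X → length σ ≤ n → σ ≼ X ↾ n
≺⇒≼↾ {σ} X {n} eq le = subst (_≼ X ↾ n) eq (↾-mono-≼ X le)

-- Lets strings share the operations on sequences. The tail of `false` is a default value: only
-- positions below the length of the string matter later on.
pad : String → Seq
pad []      _       = false
pad (b ∷ σ) zero    = b
pad (b ∷ σ) (suc i) = pad σ i

≺-pad : ∀ σ → σ ≺ pad σ
≺-pad []      = refl
≺-pad (b ∷ σ) = cong (b ∷_) (≺-pad σ)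

≼⇒pad : ∀ {σ τ i} → σ ≼ τ → i < length σ → pad τ i ≡ pad σ i
≼⇒pad {i = zero}  (refl ∷ p) _        = refl
≼⇒pad {i = suc i} (refl ∷ p) (s≤s lt) = ≼⇒pad p lt

-- Counting strings of a given length

strings : ℕ → List String
strings zero    = [] ∷ []
strings (suc n) = map (false ∷_) (strings n) ++ map (true ∷_) (strings n)

length-strings : ∀ n → length (strings n) ≡ 2 ^ n
length-strings zero    = refl
length-strings (suc n) = trans (length-++ (map (false ∷_) (strings n)))
  (cong₂ _+_ (trans (length-map _ (strings n)) (length-strings n))
             (trans (length-map _ (strings n)) (trans (length-strings n) (sym (+-identityʳ _)))))

∈-strings : ∀ σ → σ ∈ˡ strings (length σ)
∈-strings []          = here refl
∈-strings (false ∷ σ) = ∈-++⁺ˡ (∈-map⁺ (false ∷_) (∈-strings σ))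
∈-strings (true  ∷ σ) = ∈-++⁺ʳ (map (false ∷_) (strings (length σ))) (∈-map⁺ (true ∷_) (∈-strings σ))

∈-strings⁻ : ∀ n {σ} → σ ∈ˡ strings n → length σ ≡ n
∈-strings⁻ zero    (here refl) = refl
∈-strings⁻ (suc n) σ∈ with ∈-++⁻ (map (false ∷_) (strings n)) σ∈
... | inj₁ σ∈ˡ with _ , τ∈ , refl ← ∈-map⁻ (false ∷_) σ∈ˡ = cong suc (∈-strings⁻ n τ∈)
... | inj₂ σ∈ʳ with _ , τ∈ , refl ← ∈-map⁻ (true  ∷_) σ∈ʳ = cong suc (∈-strings⁻ n τ∈)

strings-unique : ∀ n → Unique (strings n)
strings-unique zero    = [] ∷ []
strings-unique (suc n) = Uniqueₚ.++⁺
  (Uniqueₚ.map⁺ ∷-injectiveʳ (strings-unique n))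
  (Uniqueₚ.map⁺ ∷-injectiveʳ (strings-unique n))
  λ (p , q) → disjoint (∈-map⁻ (false ∷_) p) (∈-map⁻ (true ∷_) q)
  where
  disjoint : ∀ {σ} → (∃[ τ ] (τ ∈ˡ strings n × σ ≡ false ∷ τ)) →
             (∃[ τ ] (τ ∈ˡ strings n × σ ≡ true ∷ τ)) → ⊥
  disjoint (_ , _ , refl) (_ , _ , ())

module _ {A : Set} where

  private
    remove : ∀ {x : A} {ys} → x ∈ˡ ys → List A
    remove {ys = _ ∷ ys} (here _)  = ys
    remove {ys = y ∷ _}  (there p) = y ∷ remove p

    length-remove : ∀ {x : A} {ys} (p : x ∈ˡ ys) → length ys ≡ suc (length (remove p))
    length-remove (here _)  = refl
    length-remove (there p) = cong suc (length-remove p)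

    ∈-remove : ∀ {x y : A} {ys} (p : x ∈ˡ ys) → x ≢ y → y ∈ˡ ys → y ∈ˡ remove p
    ∈-remove (here refl) x≢y (here refl) = contradiction refl x≢y
    ∈-remove (here refl) x≢y (there q)   = q
    ∈-remove (there p)   x≢y (here refl) = here refl
    ∈-remove (there p)   x≢y (there q)   = there (∈-remove p x≢y q)

  module _ {B : Set} (_~_ : B → A → Set) (injective : ∀ {x x′ y} → x ~ y → x′ ~ y → x ≡ x′) where

    -- Pigeonhole principle: each element of `xs` is charged to some `y`, which is then removed from
    -- `ys`; injectivity ensures that the later elements do not miss it. A relation is convenient
    -- here, since images arise from existential witnesses.
    unique⇒length≤ : ∀ {xs ys} → Unique xs → (∀ {x} → x ∈ˡ xs → ∃[ y ] (y ∈ˡ ys × x ~ y)) →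
                     length xs ≤ length ys
    unique⇒length≤ {[]}          _        _     = z≤n
    unique⇒length≤ {x ∷ xs} {ys} (x∉ ∷ u) image with y , y∈ , x~y ← image (here refl) =
      subst (suc (length xs) ≤_) (sym (length-remove y∈)) (s≤s (unique⇒length≤ u image′))
      where
      image′ : ∀ {x′} → x′ ∈ˡ xs → ∃[ y′ ] (y′ ∈ˡ remove y∈ × x′ ~ y′)
      image′ x′∈ with y′ , y′∈ , x′~y′ ← image (there x′∈) = y′ , ∈-remove y∈
        (λ { refl → All.lookup x∉ x′∈ (injective x~y x′~y′) }) y′∈ , x′~y′

length-cartesianProduct : ∀ {A B : Set} (xs : List A) {ys : List B} →
                          length (cartesianProduct xs ys) ≡ length xs * length ys
length-cartesianProduct []            = refl
length-cartesianProduct (x ∷ xs) {ys} = trans (length-++ (map (x ,_) ys))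
  (cong₂ _+_ (length-map (x ,_) ys) (length-cartesianProduct xs))

-- Values in binary notation, most significant digit first

bit : Bool → ℕ
bit b = if b then 1 else 0

val : String → ℕ
val []      = 0
val (b ∷ σ) = bit b * 2 ^ length σ + val σ

val<2^ : ∀ σ → val σ < 2 ^ length σ
val<2^ []          = ≤-refl
val<2^ (false ∷ σ) = ≤-trans (val<2^ σ) (m≤m+n _ _)
val<2^ (true  ∷ σ) = begin-strict
  (2 ^ length σ + 0) + val σ           <⟨ +-monoʳ-< _ (val<2^ σ) ⟩
  (2 ^ length σ + 0) + 2 ^ length σ    ≡⟨ +-comm (2 ^ length σ + 0) _ ⟩
  2 ^ length σ + (2 ^ length σ + 0)    ∎
  where open ≤-Reasoning

val-++ : ∀ σ τ → val (σ ++ τ) ≡ val σ * 2 ^ length τ + val τ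
val-++ []      τ = refl
val-++ (b ∷ σ) τ = begin
  bit b * 2 ^ length (σ ++ τ) + val (σ ++ τ)
    ≡⟨ cong₂ (λ n v → bit b * n + v)
         (trans (cong (2 ^_) (length-++ σ)) (^-distribˡ-+-* 2 (length σ) (length τ)))
         (val-++ σ τ) ⟩
  bit b * (2 ^ length σ * 2 ^ length τ) + (val σ * 2 ^ length τ + val τ)
    ≡⟨ cong (_+ (val σ * 2 ^ length τ + val τ)) (*-assoc (bit b) (2 ^ length σ) (2 ^ length τ)) ⟨
  bit b * 2 ^ length σ * 2 ^ length τ + (val σ * 2 ^ length τ + val τ)
    ≡⟨ +-assoc (bit b * 2 ^ length σ * 2 ^ length τ) (val σ * 2 ^ length τ) (val τ) ⟨
  bit b * 2 ^ length σ * 2 ^ length τ + val σ * 2 ^ length τ + val τ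
    ≡⟨ cong (_+ val τ) (*-distribʳ-+ (2 ^ length τ) (bit b * 2 ^ length σ) (val σ)) ⟨
  (bit b * 2 ^ length σ + val σ) * 2 ^ length τ + val τ ∎
  where open ≡-Reasoning

binary : ∀ L s → s < 2 ^ L → ∃[ q ] (length q ≡ L × val q ≡ s)
binary zero    zero    _         = [] , refl , refl
binary zero    (suc _) (s≤s ())
binary (suc L) s       s<  with s <? 2 ^ L
... | yes lt with q , refl , refl ← binary L s lt = false ∷ q , refl , refl
... | no ¬lt with q , refl , eq ← binary L (s ∸ 2 ^ L)
      (subst (s ∸ 2 ^ L <_) (trans (m+n∸m≡n (2 ^ L) _) (+-identityʳ _)) (∸-monoˡ-< s< (≮⇒≥ ¬lt)))
    = true ∷ q , refl , trans (cong₂ _+_ (+-identityʳ _) eq) (m+[n∸m]≡n (≮⇒≥ ¬lt))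

-- The bits beyond `q` add less than `2 ^ (length q' ∸ length q)`. Geometrically, the dyadic
-- interval of an extension starts inside that of `q`, so codes with disjoint intervals are
-- incomparable.
val-≼ : ∀ {q q'} → q ≼ q' → val q' < (1 + val q) * 2 ^ (length q' ∸ length q)
val-≼ {q} p with r , refl ← ≼⇒++ p = subst₂ _<_ (sym (val-++ q r))
  (cong (λ n → (1 + val q) * 2 ^ n) (sym (trans (cong (_∸ length q) (length-++ q)) (m+n∸m≡n (length q) (length r)))))
  (subst (val q * 2 ^ length r + val r <_) (+-comm (val q * 2 ^ length r) (2 ^ length r))
    (+-monoʳ-< (val q * 2 ^ length r) (val<2^ r)))

-- Computable functions on numbers, bits and strings

natrec : {Y : Set} → Y → (ℕ → Y → Y) → ℕ → Y
natrec z s zero    = z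
natrec z s (suc n) = s n (natrec z s n)

para : {Y : Set} → Y → (Bool → String → Y → Y) → String → Y
para z s []      = z
para z s (b ∷ σ) = s b σ (para z s σ)

isZero : ℕ → Bool
isZero zero    = true
isZero (suc _) = false

hd : String → Bool
hd []      = false
hd (b ∷ _) = b

tl : String → String
tl []      = []
tl (_ ∷ σ) = σ

tl-drop : ∀ n σ → tl (drop n σ) ≡ drop (suc n) σ
tl-drop zero    []      = refl
tl-drop zero    (b ∷ σ) = refl
tl-drop (suc n) []      = refl
tl-drop (suc n) (b ∷ σ) = tl-drop n σ

anyBelow : (ℕ → Bool) → ℕ → Bool
anyBelow p = natrec false (λ i y → p i ∨ y)

sumBelow : (ℕ → ℕ) → ℕ → ℕ
sumBelow f = natrec 0 (λ i y → f i + y)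

-- A string false^n true q is split into n and q.
leading : String → ℕ
leading = para 0 (λ b _ y → if b then 0 else suc y)

payload : String → String
payload = para [] (λ b ρ y → if b then ρ else y)

anyBelow⁻ : ∀ p n → anyBelow p n ≡ true → ∃[ i ] (i < n × p i ≡ true)
anyBelow⁻ p (suc n) eq with p n in pn
... | true  = n , ≤-refl , pn
... | false with i , i< , pi ← anyBelow⁻ p n eq = i , m<n⇒m<1+n i< , pi

anyBelow⁺ : ∀ p {i n} → i < n → p i ≡ true → anyBelow p n ≡ true
anyBelow⁺ p {i} {suc n} (s≤s le) pi with m≤n⇒m<n∨m≡n le
... | inj₂ refl = cong (_∨ anyBelow p i) pi
... | inj₁ lt   = trans (cong (p n ∨_) (anyBelow⁺ p lt pi)) (Boolₚ.∨-zeroʳ (p n))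

leading-block : ∀ n q → leading (replicate n false ++ true ∷ q) ≡ n
leading-block zero    q = refl
leading-block (suc n) q = cong suc (leading-block n q)

payload-block : ∀ n q → payload (replicate n false ++ true ∷ q) ≡ q
payload-block zero    q = refl
payload-block (suc n) q = payload-block n q

-- The condition on the length excludes the strings without true.
block-split : ∀ p → length p ≡ suc (leading p + length (payload p)) →
              p ≡ replicate (leading p) false ++ true ∷ payload p
block-split []          ()
block-split (true  ∷ p) _  = refl
block-split (false ∷ p) eq = cong (false ∷_) (block-split p (suc-injective eq))

-- Codes act on numbers only; a type records which coding relates a number to the value it stands
-- for.
data Ty : Set where
  nat bool str : Ty

⟦_⟧ : Ty → Set
⟦ nat  ⟧ = ℕ
⟦ bool ⟧ = Bool
⟦ str  ⟧ = String

code : ∀ t → ⟦ t ⟧ → ℕ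
code nat  n = n
code bool b = bit b
code str  σ = enc σ

Ctx : ℕ → Set
Ctx = Vec Ty

Env : ∀ {n} → Ctx n → Set
Env []      = ⊤
Env (t ∷ Γ) = ⟦ t ⟧ × Env Γ

codes : ∀ {n} (Γ : Ctx n) → Env Γ → Vec ℕ n
codes []      _       = []
codes (t ∷ Γ) (x , γ) = code t x ∷ codes Γ γ

get : ∀ {n} (Γ : Ctx n) (i : Fin n) → Env Γ → ⟦ Vec.lookup Γ i ⟧
get (t ∷ Γ) zero    (x , _) = x
get (t ∷ Γ) (suc i) (_ , γ) = get Γ i γ

lookup-codes : ∀ {n} (Γ : Ctx n) i γ →
               Vec.lookup (codes Γ γ) i ≡ code (Vec.lookup Γ i) (get Γ i γ)
lookup-codes (t ∷ Γ) zero    γ       = refl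
lookup-codes (t ∷ Γ) (suc i) (_ , γ) = lookup-codes Γ i γ

module Computability (A : Oracle) where

  private
    variable
      m n : ℕ
      Γ : Ctx n
      Δ : Ctx m
      a t : Ty

  -- Pairs a total function with a program for it, so that the combinators below build programs
  -- together with their correctness proofs. Partial functions enter only later, through `search`.
  record Computable {n : ℕ} (Γ : Ctx n) (t : Ty) (F : Env Γ → ⟦ t ⟧) : Set where
    constructor computable
    field
      prog : Code n
      runs : ∀ γ → A ⊢ prog ⟨ codes Γ γ ⟩⇓ code t (F γ)
  open Computable public

  ⇓-resp : ∀ {n} {e : Code n} {xs y z} → y ≡ z → A ⊢ e ⟨ xs ⟩⇓ y → A ⊢ e ⟨ xs ⟩⇓ z
  ⇓-resp refl d = d

  ext : ∀ {n} {Γ : Ctx n} {t F G} → (∀ γ → F γ ≡ G γ) → Computable Γ t F → Computable Γ t G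
  ext {t = t} eq c = computable (prog c) λ γ → ⇓-resp (cong (code t) (eq γ)) (runs c γ)

  private
    projections : ∀ {m n} (ρ : Fin m → Fin n) xs →
                  Pointwise (λ g y → A ⊢ g ⟨ xs ⟩⇓ y)
                    (Vec.tabulate (projᶜ ∘ ρ)) (Vec.tabulate (Vec.lookup xs ∘ ρ))
    projections {zero}  ρ xs = []
    projections {suc m} ρ xs = ⇓proj ∷ projections (ρ ∘ suc) xs

  allProj : ∀ n → Vec (Code n) n
  allProj n = Vec.tabulate projᶜ

  run-allProj : ∀ {n} (xs : Vec ℕ n) → Pointwise (λ g y → A ⊢ g ⟨ xs ⟩⇓ y) (allProj n) xs
  run-allProj xs = subst (Pointwise _ _) (Vecₚ.tabulate∘lookup xs) (projections id xs)

  var : (i : Fin n) → Computable Γ (Vec.lookup Γ i) (get Γ i)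
  var {Γ = Γ} i = computable (projᶜ i) λ γ → ⇓-resp (lookup-codes Γ i γ) ⇓proj

  wk : ∀ {F} → Computable Γ t F → Computable (a ∷ Γ) t (F ∘ proj₂)
  wk {Γ = Γ} f = computable (compᶜ (prog f) (Vec.tabulate (projᶜ ∘ suc))) λ (x , γ) →
    ⇓comp (subst (Pointwise _ _) (Vecₚ.tabulate∘lookup (codes Γ γ)) (projections suc _)) (runs f γ)

  data Args {n : ℕ} (Γ : Ctx n) : ∀ {m} (Δ : Ctx m) → (Env Γ → Env Δ) → Set where
    []  : Args Γ [] (λ _ → tt)
    _∷_ : ∀ {a m} {Δ : Ctx m} {G E} →
          Computable Γ a G → Args Γ Δ E → Args Γ (a ∷ Δ) (λ γ → G γ , E γ)

  wkᵃ : ∀ {E} → Args Γ Δ E → Args (a ∷ Γ) Δ (E ∘ proj₂)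
  wkᵃ []       = []
  wkᵃ (c ∷ cs) = wk c ∷ wkᵃ cs

  idᵃ : Args Γ Γ id
  idᵃ {Γ = []}    = []
  idᵃ {Γ = _ ∷ _} = var 0F ∷ wkᵃ idᵃ

  private
    progs : ∀ {E} → Args {n} Γ {m} Δ E → Vec (Code n) m
    progs []       = []
    progs (c ∷ cs) = prog c ∷ progs cs

    run-progs : ∀ {E} (cs : Args Γ Δ E) γ →
                Pointwise (λ g y → A ⊢ g ⟨ codes Γ γ ⟩⇓ y) (progs cs) (codes Δ (E γ))
    run-progs []       γ = []
    run-progs (c ∷ cs) γ = runs c γ ∷ run-progs cs γ

  call : ∀ {F E} → Computable Δ t F → Args Γ Δ E → Computable Γ t (F ∘ E)
  call f cs = computable (compᶜ (prog f) (progs cs)) λ γ → ⇓comp (run-progs cs γ) (runs f _)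

  bind : ∀ {G F} → Computable Γ a G → Computable (a ∷ Γ) t F → Computable Γ t (λ γ → F (G γ , γ))
  bind g f = call f (g ∷ idᵃ)

  zeroN : Computable Γ nat (λ _ → 0)
  zeroN = computable zeroᶜ λ _ → ⇓zero

  sucN : ∀ {N} → Computable Γ nat N → Computable Γ nat (suc ∘ N)
  sucN c = computable (compᶜ sucᶜ (prog c ∷ [])) λ γ → ⇓comp (runs c γ ∷ []) ⇓suc

  lit : ∀ k → Computable Γ nat (λ _ → k)
  lit zero    = zeroN
  lit (suc k) = sucN (lit k)

  trueB : Computable Γ bool (λ _ → true)
  trueB {Γ = Γ} = computable (prog {Γ = Γ} (lit 1)) (runs (lit 1))

  falseB : Computable Γ bool (λ _ → false)
  falseB {Γ = Γ} = computable (prog {Γ = Γ} (lit 0)) (runs (lit 0))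

  nilS : Computable Γ str (λ _ → [])
  nilS {Γ = Γ} = computable (prog {Γ = Γ} (lit 0)) (runs (lit 0))

  oracle : ∀ {N} → Computable Γ nat N → Computable Γ bool (A ∘ N)
  oracle c = computable (compᶜ oracleᶜ (prog c ∷ [])) λ γ → ⇓comp (runs c γ ∷ []) ⇓oracle

  -- A string is represented by its own number, so the same program serves for `S` and for
  -- `enc ∘ S`.
  encN : ∀ {S} → Computable Γ str S → Computable Γ nat (enc ∘ S)
  encN c = computable (prog c) (runs c)

  decS : ∀ {N} → Computable Γ nat N → Computable Γ str (dec ∘ N)
  decS c = computable (prog c) λ γ → ⇓-resp (sym (enc-dec _)) (runs c γ)

  bitN : ∀ {B} → Computable Γ bool B → Computable Γ nat (bit ∘ B)
  bitN c = computable (prog c) (runs c)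

  natrecᶜ : ∀ {N Z S} → Computable Γ nat N → Computable Γ t Z → Computable (nat ∷ t ∷ Γ) t S →
            Computable Γ t (λ γ → natrec (Z γ) (λ i y → S (i , y , γ)) (N γ))
  natrecᶜ {Γ = Γ} {t = t} {N} {Z} {S} n z s = computable (compᶜ (recᶜ (prog z) (prog s)) (prog n ∷ allProj _)) λ γ →
    ⇓comp (runs n γ ∷ run-allProj (codes Γ γ)) (go γ (N γ))
    where
    go : ∀ γ k → A ⊢ recᶜ (prog z) (prog s) ⟨ k ∷ codes Γ γ ⟩⇓ code t (natrec (Z γ) (λ i y → S (i , y , γ)) k)
    go γ zero    = ⇓rec0 (runs z γ)
    go γ (suc k) = ⇓rec+ (go γ k) (runs s (k , _ , γ))

  ifᶜ : ∀ {B F G} → Computable Γ bool B → Computable Γ t F → Computable Γ t G →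
        Computable Γ t (λ γ → if B γ then F γ else G γ)
  ifᶜ {B = B} {F} {G} b f g = ext (λ γ → lemma γ (B γ)) (natrecᶜ (bitN b) g (wk (wk f)))
    where
    lemma : ∀ γ b → natrec (G γ) (λ _ _ → F γ) (bit b) ≡ (if b then F γ else G γ)
    lemma γ false = refl
    lemma γ true  = refl

  notB : ∀ {B} → Computable Γ bool B → Computable Γ bool (not ∘ B)
  notB {B = B} b = ext (λ γ → lemma (B γ)) (ifᶜ b falseB trueB)
    where
    lemma : ∀ b → (if b then false else true) ≡ not b
    lemma false = refl
    lemma true  = refl

  infixr 6 _∧B_
  _∧B_ : ∀ {B C} → Computable Γ bool B → Computable Γ bool C → Computable Γ bool (λ γ → B γ ∧ C γ)
  _∧B_ {B = B} {C = C} b c = ext (λ γ → lemma (B γ)) (ifᶜ b c falseB)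
    where
    lemma : ∀ b {c} → (if b then c else false) ≡ b ∧ c
    lemma false = refl
    lemma true  = refl

  infixr 5 _∨B_
  _∨B_ : ∀ {B C} → Computable Γ bool B → Computable Γ bool C → Computable Γ bool (λ γ → B γ ∨ C γ)
  _∨B_ {B = B} {C = C} b c = ext (λ γ → lemma (B γ)) (ifᶜ b trueB c)
    where
    lemma : ∀ b {c} → (if b then true else c) ≡ b ∨ c
    lemma false = refl
    lemma true  = refl

  isZeroB : ∀ {N} → Computable Γ nat N → Computable Γ bool (isZero ∘ N)
  isZeroB {N = N} n = ext (λ γ → lemma (N γ)) (natrecᶜ n trueB falseB)
    where
    lemma : ∀ n → natrec true (λ _ _ → false) n ≡ isZero n
    lemma zero    = refl
    lemma (suc n) = refl

  predN : ∀ {N} → Computable Γ nat N → Computable Γ nat (pred ∘ N)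
  predN {N = N} n = ext (λ γ → lemma (N γ)) (natrecᶜ n zeroN (var 0F))
    where
    lemma : ∀ n → natrec 0 (λ i _ → i) n ≡ pred n
    lemma zero    = refl
    lemma (suc n) = refl

  infixl 6 _+N_ _∸N_
  infixl 7 _*N_
  infix 4 _≤ᵇB_ _≡ᵇB_

  _+N_ : ∀ {M N} → Computable Γ nat M → Computable Γ nat N → Computable Γ nat (λ γ → M γ + N γ)
  _+N_ {M = M} {N = N} a b = ext (λ γ → lemma (M γ) (N γ)) (natrecᶜ a b (sucN (var 1F)))
    where
    lemma : ∀ m n → natrec n (λ _ → suc) m ≡ m + n
    lemma zero    n = refl
    lemma (suc m) n = cong suc (lemma m n)

  _∸N_ : ∀ {M N} → Computable Γ nat M → Computable Γ nat N → Computable Γ nat (λ γ → M γ ∸ N γ)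
  _∸N_ {M = M} {N = N} a b = ext (λ γ → lemma (M γ) (N γ)) (natrecᶜ b a (predN (var 1F)))
    where
    lemma : ∀ m n → natrec m (λ _ → pred) n ≡ m ∸ n
    lemma m zero    = refl
    lemma m (suc n) = trans (cong pred (lemma m n)) (pred[m∸n]≡m∸[1+n] m n)

  _*N_ : ∀ {M N} → Computable Γ nat M → Computable Γ nat N → Computable Γ nat (λ γ → M γ * N γ)
  _*N_ {M = M} {N = N} a b = ext (λ γ → lemma (M γ) (N γ)) (natrecᶜ a (lit 0) (wk (wk b) +N var 1F))
    where
    lemma : ∀ m n → natrec 0 (λ _ y → n + y) m ≡ m * n
    lemma zero    n = refl
    lemma (suc m) n = cong (n +_) (lemma m n)

  2^N : ∀ {N} → Computable Γ nat N → Computable Γ nat (λ γ → 2 ^ N γ)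
  2^N {N = N} a = ext (λ γ → lemma (N γ)) (natrecᶜ a (lit 1) (lit 2 *N var 1F))
    where
    lemma : ∀ m → natrec 1 (λ _ y → 2 * y) m ≡ 2 ^ m
    lemma zero    = refl
    lemma (suc m) = cong (2 *_) (lemma m)

  _≤ᵇB_ : ∀ {M N} → Computable Γ nat M → Computable Γ nat N → Computable Γ bool (λ γ → M γ ≤ᵇ N γ)
  _≤ᵇB_ {M = M} {N = N} a b = ext (λ γ → lemma (M γ) (N γ)) (isZeroB (a ∸N b))
    where
    lemma : ∀ m n → isZero (m ∸ n) ≡ (m ≤ᵇ n)
    lemma zero          n       = cong isZero (0∸n≡0 n)
    lemma (suc m)       zero    = refl
    lemma (suc zero)    (suc n) = lemma zero n
    lemma (suc (suc m)) (suc n) = lemma (suc m) n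

  _≡ᵇB_ : ∀ {M N} → Computable Γ nat M → Computable Γ nat N → Computable Γ bool (λ γ → M γ ≡ᵇ N γ)
  _≡ᵇB_ {M = M} {N = N} a b = ext (λ γ → lemma (M γ) (N γ)) (isZeroB (a ∸N b) ∧B isZeroB (b ∸N a))
    where
    lemma : ∀ m n → isZero (m ∸ n) ∧ isZero (n ∸ m) ≡ (m ≡ᵇ n)
    lemma zero    zero    = refl
    lemma zero    (suc n) = refl
    lemma (suc m) zero    = refl
    lemma (suc m) (suc n) = lemma m n

  consS : ∀ {B S} → Computable Γ bool B → Computable Γ str S → Computable Γ str (λ γ → B γ ∷ S γ)
  consS {Γ = Γ} {B = B} {S} b s = computable (prog num) λ γ → ⇓-resp (lemma (B γ) (S γ)) (runs num γ)
    where
    num : Computable Γ nat (λ γ → 1 + bit (B γ) + 2 * enc (S γ))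
    num = lit 1 +N bitN b +N lit 2 *N encN s
    lemma : ∀ b σ → 1 + bit b + 2 * enc σ ≡ enc (b ∷ σ)
    lemma false σ = refl
    lemma true  σ = refl

  -- The first digit and the rest of dec n are computed by recursion on n, following the definition of next.
  hdB : ∀ {S} → Computable Γ str S → Computable Γ bool (hd ∘ S)
  hdB {S = S} s = ext (λ γ → trans (lemma (enc (S γ))) (cong hd (dec-enc (S γ))))
    (natrecᶜ (encN s) falseB (ifᶜ (isZeroB (var 0F)) falseB (notB (var 1F))))
    where
    step : ℕ → Bool → Bool
    step i y = if isZero i then false else not y
    hd-next : ∀ σ → step (enc σ) (hd σ) ≡ hd (next σ)
    hd-next []          = refl
    hd-next (false ∷ σ) = refl
    hd-next (true  ∷ σ) = refl
    lemma : ∀ n → natrec false step n ≡ hd (dec n)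
    lemma zero    = refl
    lemma (suc n) = trans (cong₂ step (sym (enc-dec n)) (lemma n)) (hd-next (dec n))

  tlS : ∀ {S} → Computable Γ str S → Computable Γ str (tl ∘ S)
  tlS {S = S} s = ext (λ γ → trans (lemma (enc (S γ))) (cong tl (dec-enc (S γ))))
    (natrecᶜ (encN s) nilS
      (ifᶜ (hdB (decS (var 0F))) (decS (sucN (encN (var 1F)))) (var 1F)))
    where
    step : ℕ → String → String
    step i y = if hd (dec i) then dec (suc (enc y)) else y
    tl-next : ∀ σ → (if hd σ then dec (suc (enc (tl σ))) else tl σ) ≡ tl (next σ)
    tl-next []          = refl
    tl-next (false ∷ σ) = refl
    tl-next (true  ∷ σ) = cong next (dec-enc σ)
    lemma : ∀ n → natrec [] step n ≡ tl (dec n)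
    lemma zero    = refl
    lemma (suc n) = trans (cong (step n) (lemma n)) (tl-next (dec n))

  dropS : ∀ {N S} → Computable Γ nat N → Computable Γ str S → Computable Γ str (λ γ → drop (N γ) (S γ))
  dropS {N = N} {S} n s = ext (λ γ → lemma (N γ) (S γ)) (natrecᶜ n s (tlS (var 1F)))
    where
    lemma : ∀ n σ → natrec σ (λ _ → tl) n ≡ drop n σ
    lemma zero    σ = refl
    lemma (suc n) σ = trans (cong tl (lemma n σ)) (tl-drop n σ)

  -- The values of the recursion on the suffixes of σ, from the shortest on: since length σ ≤ enc σ,
  -- the suffix drop (enc σ ∸ k) σ is empty for k = 0 and all of σ for k = enc σ.
  paraᶜ : ∀ {S Z F} → Computable Γ str S → Computable Γ t Z → Computable (bool ∷ str ∷ t ∷ Γ) t F →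
          Computable Γ t (λ γ → para (Z γ) (λ b ρ y → F (b , ρ , y , γ)) (S γ))
  paraᶜ {Γ = Γ} {t = t} {S} {Z} {F} s z f = ext
    (λ γ → trans (lemma (Z γ) (λ b ρ y → F (b , ρ , y , γ)) (S γ) _ ≤-refl)
                 (cong (λ k → para (Z γ) (λ b ρ y → F (b , ρ , y , γ)) (drop k (S γ))) (n∸n≡0 (enc (S γ)))))
    (natrecᶜ (encN s) z
      (bind (dropS (encN (wk (wk s)) ∸N sucN (var 0F)) (wk (wk s)))
        (ifᶜ (isZeroB (encN (var 0F)))
           (var 2F)
           (call f (hdB (var 0F) ∷ tlS (var 0F) ∷ var 2F ∷ wkᵃ (wkᵃ (wkᵃ idᵃ)))))))
    where
    module _ (z : ⟦ t ⟧) (f : Bool → String → ⟦ t ⟧ → ⟦ t ⟧) (σ : String) where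
      unfold : ⟦ t ⟧ → String → ⟦ t ⟧
      unfold y ρ = if isZero (enc ρ) then y else f (hd ρ) (tl ρ) y

      unfold-para : ∀ ρ → unfold (para z f (tl ρ)) ρ ≡ para z f ρ
      unfold-para []          = refl
      unfold-para (false ∷ ρ) = refl
      unfold-para (true  ∷ ρ) = refl

      lemma : ∀ k → k ≤ enc σ →
              natrec z (λ i y → unfold y (drop (enc σ ∸ suc i) σ)) k ≡ para z f (drop (enc σ ∸ k) σ)
      lemma zero    _  = cong (para z f) (sym (drop-all (enc σ) σ (length≤enc σ)))
      lemma (suc k) lt = begin
        unfold (natrec z _ k) ρ                    ≡⟨ cong (λ y → unfold y ρ) (lemma k (<⇒≤ lt)) ⟩
        unfold (para z f (drop (enc σ ∸ k) σ)) ρ   ≡⟨ cong (λ i → unfold (para z f (drop i σ)) ρ) (+-∸-assoc 1 lt) ⟩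
        unfold (para z f (drop (suc j) σ)) ρ       ≡⟨ cong (λ υ → unfold (para z f υ) ρ) (tl-drop j σ) ⟨
        unfold (para z f (tl ρ)) ρ                 ≡⟨ unfold-para ρ ⟩
        para z f ρ                                 ∎
        where
        open ≡-Reasoning
        j = enc σ ∸ suc k
        ρ = drop j σ

  lengthN : ∀ {S} → Computable Γ str S → Computable Γ nat (length ∘ S)
  lengthN {S = S} s = ext (λ γ → lemma (S γ)) (paraᶜ s (lit 0) (sucN (var 2F)))
    where
    lemma : ∀ σ → para 0 (λ _ _ → suc) σ ≡ length σ
    lemma []      = refl
    lemma (b ∷ σ) = cong suc (lemma σ)

  snocS : ∀ {S B} → Computable Γ str S → Computable Γ bool B → Computable Γ str (λ γ → S γ ∷ʳ B γ)
  snocS {S = S} {B = B} s b = ext (λ γ → lemma (S γ) (B γ))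
    (paraᶜ s (consS b nilS) (consS (var 0F) (var 2F)))
    where
    lemma : ∀ σ b → para (b ∷ []) (λ c _ y → c ∷ y) σ ≡ σ ∷ʳ b
    lemma []      b = refl
    lemma (c ∷ σ) b = cong (c ∷_) (lemma σ b)

  padB : ∀ {S N} → Computable Γ str S → Computable Γ nat N → Computable Γ bool (λ γ → pad (S γ) (N γ))
  padB {S = S} {N = N} s n = ext (λ γ → lemma (S γ) (N γ)) (hdB (dropS n s))
    where
    lemma : ∀ σ n → hd (drop n σ) ≡ pad σ n
    lemma []      zero    = refl
    lemma []      (suc n) = refl
    lemma (b ∷ σ) zero    = refl
    lemma (b ∷ σ) (suc n) = lemma σ n

  pad-↾S : ∀ {S N} → Computable Γ str S → Computable Γ nat N → Computable Γ str (λ γ → pad (S γ) ↾ N γ)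
  pad-↾S {S = S} {N = N} s n = ext (λ γ → lemma (pad (S γ)) (N γ))
    (natrecᶜ n nilS (snocS (var 1F) (padB (wk (wk s)) (var 0F))))
    where
    lemma : ∀ X n → natrec [] (λ i y → y ∷ʳ X i) n ≡ X ↾ n
    lemma X zero    = refl
    lemma X (suc n) = trans (cong (_∷ʳ X n) (lemma X n)) (sym (↾-suc X n))

  valN : ∀ {S} → Computable Γ str S → Computable Γ nat (val ∘ S)
  valN {S = S} s = ext (λ γ → lemma (S γ))
    (paraᶜ s (lit 0) (bitN (var 0F) *N 2^N (lengthN (var 1F)) +N var 2F))
    where
    lemma : ∀ σ → para 0 (λ b ρ y → bit b * 2 ^ length ρ + y) σ ≡ val σ
    lemma []      = refl
    lemma (b ∷ σ) = cong (bit b * 2 ^ length σ +_) (lemma σ)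

  leadingN : ∀ {S} → Computable Γ str S → Computable Γ nat (leading ∘ S)
  leadingN s = paraᶜ s (lit 0) (ifᶜ (var 0F) (lit 0) (sucN (var 2F)))

  payloadS : ∀ {S} → Computable Γ str S → Computable Γ str (payload ∘ S)
  payloadS s = paraᶜ s nilS (ifᶜ (var 0F) (var 1F) (var 2F))

  wk₁ : ∀ {F} → Computable (nat ∷ Γ) t F → Computable (nat ∷ a ∷ Γ) t (λ (i , _ , γ) → F (i , γ))
  wk₁ f = call f (var 0F ∷ wkᵃ (wkᵃ idᵃ))

  anyBelowB : ∀ {N P} → Computable Γ nat N → Computable (nat ∷ Γ) bool P →
              Computable Γ bool (λ γ → anyBelow (λ i → P (i , γ)) (N γ))
  anyBelowB n p = natrecᶜ n falseB (wk₁ p ∨B var 1F)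

  sumBelowN : ∀ {N F} → Computable Γ nat N → Computable (nat ∷ Γ) nat F →
              Computable Γ nat (λ γ → sumBelow (λ i → F (i , γ)) (N γ))
  sumBelowN n f = natrecᶜ n (lit 0) (wk₁ f +N var 1F)

-- Step-bounded evaluation

allPositive : ∀ {m} → Vec ℕ m → Bool
allPositive []       = true
allPositive (v ∷ vs) = not (isZero v) ∧ allPositive vs

allPositive-suc : ∀ {m} (ys : Vec ℕ m) → allPositive (Vec.map suc ys) ≡ true
allPositive-suc []       = refl
allPositive-suc (y ∷ ys) = allPositive-suc ys

map-pred-suc : ∀ {m} (ys : Vec ℕ m) → Vec.map pred (Vec.map suc ys) ≡ ys
map-pred-suc []       = refl
map-pred-suc (y ∷ ys) = cong (y ∷_) (map-pred-suc ys)

module Evaluation (A : Oracle) where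

  open Computability A

  -- State of the search for a zero: 0 while the values are positive, 1 once an undefined value is met,
  -- 2 + i once a zero is found at i.
  searchStep : ℕ → ℕ → ℕ
  searchStep i v = if isZero v then 1 else if isZero (pred v) then 2 + i else 0

  searchUpTo : (ℕ → ℕ) → ℕ → ℕ
  searchUpTo f = natrec 0 (λ i r → if isZero r then searchStep i (f i) else r)

  -- Unbounded search is cut off at s; the value 0 means undefined and suc y means y.
  eval  : ∀ {n} → Code n → ℕ → Vec ℕ n → ℕ
  evals : ∀ {m n} → Vec (Code n) m → ℕ → Vec ℕ n → Vec ℕ m

  eval zeroᶜ        s xs       = 1
  eval sucᶜ         s (x ∷ []) = 2 + x
  eval (projᶜ i)    s xs       = suc (Vec.lookup xs i)
  eval oracleᶜ      s (x ∷ []) = suc (bit (A x))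
  eval (compᶜ f gs) s xs       =
    if allPositive (evals gs s xs) then eval f s (Vec.map pred (evals gs s xs)) else 0
  eval (recᶜ f g)   s (k ∷ xs) =
    natrec (eval f s xs) (λ i r → if isZero r then 0 else eval g s (i ∷ pred r ∷ xs)) k
  eval (muᶜ f)      s xs       = pred (searchUpTo (λ i → eval f s (i ∷ xs)) s)

  evals []       s xs = []
  evals (g ∷ gs) s xs = eval g s xs ∷ evals gs s xs

  eval-sound  : ∀ {n} (c : Code n) s xs {y} → eval c s xs ≡ suc y → A ⊢ c ⟨ xs ⟩⇓ y
  evals-sound : ∀ {m n} (gs : Vec (Code n) m) s xs → allPositive (evals gs s xs) ≡ true →
                Pointwise (λ g y → A ⊢ g ⟨ xs ⟩⇓ y) gs (Vec.map pred (evals gs s xs))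

  eval-sound zeroᶜ        s xs       refl = ⇓zero
  eval-sound sucᶜ         s (x ∷ []) refl = ⇓suc
  eval-sound (projᶜ i)    s xs       refl = ⇓proj
  eval-sound oracleᶜ      s (x ∷ []) refl = ⇓oracle
  eval-sound (compᶜ f gs) s xs       eq with allPositive (evals gs s xs) in pos
  ... | true  = ⇓comp (evals-sound gs s xs pos) (eval-sound f s _ eq)
  eval-sound (recᶜ f g)   s (k ∷ xs) eq = go k eq
    where
    go : ∀ k {y} → natrec (eval f s xs) (λ i r → if isZero r then 0 else eval g s (i ∷ pred r ∷ xs)) k ≡ suc y →
         A ⊢ recᶜ f g ⟨ k ∷ xs ⟩⇓ y
    go zero    eq = ⇓rec0 (eval-sound f s xs eq)
    go (suc k) eq with natrec (eval f s xs) (λ i r → if isZero r then 0 else eval g s (i ∷ pred r ∷ xs)) k in eqk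
    ... | suc r = ⇓rec+ (go k eqk) (eval-sound g s _ eq)
  eval-sound (muᶜ f)      s xs {y}   eq = found s y (pred≡suc eq)
    where
    v = λ i → eval f s (i ∷ xs)
    pred≡suc : ∀ {r y} → pred r ≡ suc y → r ≡ 2 + y
    pred≡suc {suc _} refl = refl
    searching : ∀ i → searchUpTo v i ≡ 0 → ∀ z → z < i → ∃[ k ] A ⊢ f ⟨ z ∷ xs ⟩⇓ suc k
    searching (suc i) eq z z< with searchUpTo v i in eqi
    searching (suc i) eq z (s≤s z≤) | zero with v i in eqv
    searching (suc i) eq z (s≤s z≤) | zero | suc (suc k) with m≤n⇒m<n∨m≡n z≤
    ... | inj₁ z<i  = searching i eqi z z<i
    ... | inj₂ refl = k , eval-sound f s _ eqv
    found : ∀ i y → searchUpTo v i ≡ 2 + y → A ⊢ muᶜ f ⟨ xs ⟩⇓ y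
    found (suc i) y eq with searchUpTo v i in eqi
    ... | suc r = found i y (trans eqi eq)
    ... | zero with v i in eqv
    found (suc i) y refl | zero | suc zero = ⇓mu (eval-sound f s _ eqv) (searching i eqi)

  evals-sound []       s xs pos = []
  evals-sound (g ∷ gs) s xs pos with eval g s xs in eq
  ... | suc _ = eval-sound g s xs eq ∷ evals-sound gs s xs pos

  -- Convergence is stated for all large bounds, not for some bound: the thresholds of finitely many
  -- subcomputations can then be joined by a maximum, without a proof that `eval` is monotone in
  -- `s`.
  Eventually : (ℕ → Set) → Set
  Eventually Q = ∃[ s₀ ] ∀ s → s₀ ≤ s → Q s

  always : ∀ {Q : ℕ → Set} → (∀ s → Q s) → Eventually Q
  always q = 0 , λ s _ → q s

  _⟨×⟩_ : ∀ {Q R : ℕ → Set} → Eventually Q → Eventually R → Eventually (λ s → Q s × R s)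
  (s₁ , q) ⟨×⟩ (s₂ , r) = s₁ ⊔ s₂ , λ s le →
    q s (≤-trans (m≤m⊔n s₁ s₂) le) , r s (≤-trans (m≤n⊔m s₁ s₂) le)

  mapᵉ : ∀ {Q R : ℕ → Set} → (∀ {s} → Q s → R s) → Eventually Q → Eventually R
  mapᵉ f (s₀ , q) = s₀ , λ s le → f (q s le)

  eventually-∀< : ∀ {Q : ℕ → ℕ → Set} y → (∀ z → z < y → Eventually (Q z)) →
                  Eventually (λ s → ∀ z → z < y → Q z s)
  eventually-∀< zero    _ = always λ _ _ ()
  eventually-∀< (suc y) q = mapᵉ (λ (h , hy) z z< → lemma h hy z<)
    (eventually-∀< y (λ z z< → q z (m<n⇒m<1+n z<)) ⟨×⟩ q y ≤-refl)
    where
    lemma : ∀ {R : ℕ → Set} → (∀ z → z < y → R z) → R y → ∀ {z} → z < suc y → R z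
    lemma h hy (s≤s z≤) with m≤n⇒m<n∨m≡n z≤
    ... | inj₁ z<   = h _ z<
    ... | inj₂ refl = hy

  module _ (v : ℕ → ℕ) {y : ℕ} (v0 : v y ≡ 1) (v+ : ∀ z → z < y → ∃[ k ] v z ≡ 2 + k) where
    private
      before : ∀ i → i ≤ y → searchUpTo v i ≡ 0
      before zero    _  = refl
      before (suc i) lt rewrite before i (<⇒≤ lt) | proj₂ (v+ i lt) = refl

    searchUpTo-found : ∀ {i} → y < i → searchUpTo v i ≡ 2 + y
    searchUpTo-found {suc i} (s≤s y≤) with m≤n⇒m<n∨m≡n y≤
    ... | inj₁ y<   rewrite searchUpTo-found y< = refl
    ... | inj₂ refl rewrite before y ≤-refl | v0 = refl

  eval-complete  : ∀ {n} {c : Code n} {xs y} → A ⊢ c ⟨ xs ⟩⇓ y → Eventually (λ s → eval c s xs ≡ suc y)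
  evals-complete : ∀ {m n} {gs : Vec (Code n) m} {xs ys} → Pointwise (λ g y → A ⊢ g ⟨ xs ⟩⇓ y) gs ys →
                   Eventually (λ s → evals gs s xs ≡ Vec.map suc ys)

  eval-complete ⇓zero   = always λ _ → refl
  eval-complete ⇓suc    = always λ _ → refl
  eval-complete ⇓proj   = always λ _ → refl
  eval-complete ⇓oracle = always λ _ → refl
  eval-complete {c = compᶜ f gs} {xs} (⇓comp {ys = ys} ds d) =
    mapᵉ (λ {s} (eqs , eq) → lemma s eqs eq) (evals-complete ds ⟨×⟩ eval-complete d)
    where
    lemma : ∀ s {z} → evals gs s xs ≡ Vec.map suc ys → eval f s ys ≡ z →
            eval (compᶜ f gs) s xs ≡ z
    lemma s eqs eq rewrite eqs | allPositive-suc ys | map-pred-suc ys = eq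
  eval-complete (⇓rec0 d) = eval-complete d
  eval-complete {c = recᶜ f g} (⇓rec+ {k = k} {xs} {y} d₁ d₂) =
    mapᵉ (λ {s} (eq₁ , eq₂) → lemma s eq₁ eq₂) (eval-complete d₁ ⟨×⟩ eval-complete d₂)
    where
    lemma : ∀ s {z} → eval (recᶜ f g) s (k ∷ xs) ≡ suc y → eval g s (k ∷ y ∷ xs) ≡ z →
            eval (recᶜ f g) s (suc k ∷ xs) ≡ z
    lemma s eq₁ eq₂ rewrite eq₁ = eq₂
  eval-complete {c = muᶜ f} {xs} {y} (⇓mu d h) =
    mapᵉ (λ {s} (y< , eq , pos) → cong pred (searchUpTo-found (λ i → eval f s (i ∷ xs)) eq pos y<))
      -- The search visits only arguments below `s`, so `s` has to exceed `y`.
      ((suc y , λ _ le → le) ⟨×⟩ (eval-complete d ⟨×⟩ eventually-∀< y λ z z< → positive z z<))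
    where
    positive : ∀ z → z < y → Eventually (λ s → ∃[ k ] eval f s (z ∷ xs) ≡ 2 + k)
    positive z z< with k , dz ← h z z< = mapᵉ (k ,_) (eval-complete dz)

  evals-complete []       = always λ _ → refl
  evals-complete (d ∷ ds) = mapᵉ (λ (eq , eqs) → cong₂ _∷_ eq eqs) (eval-complete d ⟨×⟩ evals-complete ds)

  -- For a large enough bound, the function `eval` takes both values.
  ⇓-deterministic : ∀ {n} {c : Code n} {xs y z} → A ⊢ c ⟨ xs ⟩⇓ y → A ⊢ c ⟨ xs ⟩⇓ z → y ≡ z
  ⇓-deterministic d₁ d₂ with s , h ← eval-complete d₁ ⟨×⟩ eval-complete d₂
    with eq₁ , eq₂ ← h s ≤-refl = suc-injective (trans (sym eq₁) eq₂)

  nats : ∀ n → Ctx n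
  nats n = Vec.replicate n nat

  fromVec : ∀ {n} → Vec ℕ n → Env (nats n)
  fromVec []       = tt
  fromVec (x ∷ xs) = x , fromVec xs

  codes-fromVec : ∀ {n} (xs : Vec ℕ n) → codes (nats n) (fromVec xs) ≡ xs
  codes-fromVec []       = refl
  codes-fromVec (x ∷ xs) = cong (x ∷_) (codes-fromVec xs)

  -- The evaluator is assembled by recursion on the fixed code, which takes the place of a universal
  -- machine for numbered codes. The cut-off `s` is what makes it total.
  evalN  : ∀ {n} (c : Code n) → Computable (nat ∷ nats n) nat (λ (s , γ) → eval c s (codes (nats n) γ))
  predsN : ∀ {m n} (gs : Vec (Code n) m) → Args (nat ∷ nats n) (nats m)
             (λ (s , γ) → fromVec (Vec.map pred (evals gs s (codes (nats n) γ))))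
  allPositiveB : ∀ {m n} (gs : Vec (Code n) m) → Computable (nat ∷ nats n) bool
             (λ (s , γ) → allPositive (evals gs s (codes (nats n) γ)))

  evalN zeroᶜ        = lit 1
  evalN sucᶜ         = sucN (sucN (var 1F))
  evalN (projᶜ i)    = computable (compᶜ sucᶜ (projᶜ (suc i) ∷ [])) λ _ → ⇓comp (⇓proj ∷ []) ⇓suc
  evalN oracleᶜ      = sucN (bitN (oracle (var 1F)))
  evalN (compᶜ f gs) = ifᶜ (allPositiveB gs)
    (ext (λ (s , γ) → cong (eval f s) (codes-fromVec _)) (call (evalN f) (var 0F ∷ predsN gs))) (lit 0)
  evalN (recᶜ f g)   = natrecᶜ (var 1F) (call (evalN f) (var 0F ∷ wkᵃ (wkᵃ idᵃ)))
    (ifᶜ (isZeroB (var 1F)) (lit 0)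
      (call (evalN g) (var 2F ∷ var 0F ∷ predN (var 1F) ∷
        wkᵃ (wkᵃ (wkᵃ (wkᵃ idᵃ))))))
  evalN (muᶜ f)      = predN (natrecᶜ (var 0F) (lit 0)
    (ifᶜ (isZeroB (var 1F))
      (bind (call (evalN f) (var 2F ∷ var 0F ∷ wkᵃ (wkᵃ (wkᵃ idᵃ))))
        (ifᶜ (isZeroB (var 0F)) (lit 1)
          (ifᶜ (isZeroB (predN (var 0F))) (sucN (sucN (var 1F))) (lit 0))))
      (var 1F)))

  predsN []       = []
  predsN (g ∷ gs) = predN (evalN g) ∷ predsN gs

  allPositiveB []       = trueB
  allPositiveB (g ∷ gs) = notB (isZeroB (evalN g)) ∧B allPositiveB gs

  -- Turns a decidable relation into a partial function defined exactly where a witness exists. Both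
  -- the test and the machine below have this form. The negation appears because `muᶜ` looks for the
  -- value 0.
  search : ∀ {n} {Γ : Ctx n} {F} → Computable (str ∷ Γ) bool F → Code n
  search f = muᶜ (prog (bitN (notB f)))

  private
    runs-dec : ∀ {n} {Γ : Ctx n} {F} (f : Computable (str ∷ Γ) bool F) z γ →
               A ⊢ prog (bitN (notB f)) ⟨ z ∷ codes Γ γ ⟩⇓ bit (not (F (dec z , γ)))
    runs-dec {Γ = Γ} {F = F} f z γ = subst (λ k → A ⊢ _ ⟨ k ∷ codes Γ γ ⟩⇓ bit (not (F (dec z , γ))))
      (enc-dec z) (runs (bitN (notB f)) (dec z , γ))

  search-sound : ∀ {n} {Γ : Ctx n} {F} (f : Computable (str ∷ Γ) bool F) γ {y} →
                 A ⊢ search f ⟨ codes Γ γ ⟩⇓ y → F (dec y , γ) ≡ true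
  search-sound {F = F} f γ {y} (⇓mu d _) with F (dec y , γ) | ⇓-deterministic d (runs-dec f y γ)
  ... | true | _ = refl

  search-complete : ∀ {n} {Γ : Ctx n} {F} (f : Computable (str ∷ Γ) bool F) γ {σ} → F (σ , γ) ≡ true →
                    ∃[ τ ] A ⊢ search f ⟨ codes Γ γ ⟩⇓ enc τ × F (τ , γ) ≡ true
  search-complete {Γ = Γ} {F = F} f γ {σ} eq =
    least (enc σ) 0 (λ _ ()) (trans (cong (λ τ → F (τ , γ)) (trans (cong dec (+-identityʳ (enc σ))) (dec-enc σ))) eq)
    where
    least : ∀ k z → (∀ i → i < z → F (dec i , γ) ≡ false) → F (dec (k + z) , γ) ≡ true →
            ∃[ τ ] A ⊢ search f ⟨ codes Γ γ ⟩⇓ enc τ × F (τ , γ) ≡ true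
    least k z below eq with F (dec z , γ) in eqz
    ... | true  = dec z , ⇓-resp (sym (enc-dec z)) (⇓mu
      (⇓-resp (cong (bit ∘ not) eqz) (runs-dec f z γ))
      (λ i i< → 0 , ⇓-resp (cong (bit ∘ not) (below i i<)) (runs-dec f i γ))) , eqz
    least zero    z below eq | false = contradiction (trans (sym eqz) eq) λ ()
    least (suc k) z below eq | false = least k (suc z) below′
      (trans (cong (λ j → F (dec j , γ)) (+-suc k z)) eq)
      where
      below′ : ∀ i → i < suc z → F (dec i , γ) ≡ false
      below′ i (s≤s i≤) with m≤n⇒m<n∨m≡n i≤
      ... | inj₁ i<   = below i i<
      ... | inj₂ refl = eqz

-- Compression yields a test

T⇒true : ∀ {b} → Data.Bool.Base.T b → b ≡ true
T⇒true {true} _ = refl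

true⇒T : ∀ {b} → b ≡ true → Data.Bool.Base.T b
true⇒T refl = tt

≡ᵇ⁻ : ∀ m n → (m ≡ᵇ n) ≡ true → m ≡ n
≡ᵇ⁻ m n eq = ≡ᵇ⇒≡ m n (true⇒T eq)

≡ᵇ⁺ : ∀ {m n} → m ≡ n → (m ≡ᵇ n) ≡ true
≡ᵇ⁺ {m} {n} eq = T⇒true (≡⇒≡ᵇ m n eq)

∧⁻ : ∀ {a b} → a ∧ b ≡ true → a ≡ true × b ≡ true
∧⁻ {true} eq = refl , eq

∧⁺ : ∀ {a b} → a ≡ true → b ≡ true → a ∧ b ≡ true
∧⁺ refl refl = refl

not⁻ : ∀ {a} → not a ≡ true → a ≡ false
not⁻ {false} _ = refl

true≢false : ∀ {a} → a ≡ true → a ≡ false → ⊥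
true≢false refl ()

module _ (A : Oracle) where
  open Computability A
  open Evaluation A

  module CompressionTest (U : Code 1) (U-pf : PrefixFree A U)
    (f : String → String) (fᶜ : Computable (str ∷ []) str (λ (σ , _) → f σ)) where

    -- The saving is measured against the length of `f σ`, not of `σ`. With `f` the identity this is
    -- ordinary compressibility; with `f` the branching bits and `σ` on a path, the length is the
    -- value of `θ`.
    Compressible : ℕ → String → Set
    Compressible c ρ = ∃[ p ] ∃[ σ ] (A ⊢ U ⟦ p ⟧≡ σ × f σ ≡ ρ × length p + c ≤ length ρ)

    private
      -- One search string carries two unknowns: the evaluation bound `leading z` and the program
      -- `payload z`.
      output : String → ℕ
      output z = eval U (leading z) (enc (payload z) ∷ [])

      witness : Env (str ∷ nat ∷ str ∷ []) → Bool
      witness (z , c , ρ , _) = not (isZero (output z))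
        ∧ (enc (f (dec (pred (output z)))) ≡ᵇ enc ρ)
        ∧ (length (payload z) + c ≤ᵇ length ρ)

      abstract
        outputN : Computable (str ∷ nat ∷ str ∷ []) nat (λ (z , _) → output z)
        outputN = call (evalN U) (leadingN (var 0F) ∷ encN (payloadS (var 0F)) ∷ [])

        witnessB : Computable (str ∷ nat ∷ str ∷ []) bool witness
        witnessB = notB (isZeroB outputN)
          ∧B (encN (call fᶜ (decS (predN outputN) ∷ [])) ≡ᵇB encN (var 2F))
          ∧B (lengthN (payloadS (var 0F)) +N var 1F ≤ᵇB lengthN (var 2F))

    test : Code 2
    test = search witnessB

    test-sound : ∀ c ρ → W[ A , test ] c ρ → Compressible c ρ
    test-sound c ρ (y , d) = extract (output z) refl (search-sound witnessB (c , ρ , tt) d)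
      where
      z = dec y
      extract : ∀ r → output z ≡ r →
                not (isZero r) ∧ (enc (f (dec (pred r))) ≡ᵇ enc ρ) ∧ (length (payload z) + c ≤ᵇ length ρ) ≡ true →
                Compressible c ρ
      extract (suc r) out w =
        payload z , dec r , ⇓-resp (sym (enc-dec r)) (eval-sound U (leading z) _ out) ,
        enc-injective (≡ᵇ⁻ _ _ (proj₁ (∧⁻ w))) ,
        ≤ᵇ⇒≤ _ _ (true⇒T (proj₂ (∧⁻ {enc (f (dec r)) ≡ᵇ enc ρ} w)))

    test-complete : ∀ c ρ → Compressible c ρ → W[ A , test ] c ρ
    test-complete c ρ (p , σ , d , eq , short) with s₀ , h ← eval-complete d
      = enc (proj₁ found) , proj₁ (proj₂ found)
      where
      z = replicate s₀ false ++ true ∷ p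
      out : output z ≡ suc (enc σ)
      out = trans (cong₂ (λ s q → eval U s (enc q ∷ [])) (leading-block s₀ p) (payload-block s₀ p)) (h s₀ ≤-refl)
      found = search-complete witnessB (c , ρ , tt) {z}
        (∧⁺ (cong (not ∘ isZero) out)
        (∧⁺ (≡ᵇ⁺ (cong enc (trans (cong (f ∘ dec ∘ pred) out) (trans (cong f (dec-enc σ)) eq))))
            (T⇒true (≤⇒≤ᵇ (subst (λ q → length q + c ≤ length ρ) (sym (payload-block s₀ p)) short)))))

    -- Replacing the prefix f σ of τ by a program p for σ, padded with c free bits ν, turns the pairs (τ , ν)
    -- into distinct strings of the length of τ.
    test-measure : MLTest A test
    test-measure c N F F! all = begin
      length F * 2 ^ c                              ≡⟨ cong (length F *_) (length-strings c) ⟨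
      length F * length (strings c)                 ≡⟨ length-cartesianProduct F ⟨
      length (cartesianProduct F (strings c))       ≤⟨ unique⇒length≤ _~_ injective
                                                         (Uniqueₚ.cartesianProduct⁺ F! (strings-unique c)) image ⟩
      length (strings N)                            ≡⟨ length-strings N ⟩
      2 ^ N                                         ∎
      where
      open ≤-Reasoning

      word : String → String → String → String → String
      -- The block of `false` makes up for what the program saves beyond `c` bits, so that the word
      -- gets the length of `τ`.
      word p ρ ν μ = p ++ replicate (length ρ ∸ (length p + c)) false ++ ν ++ μ

      _~_ : String × String → String → Set
      (τ , ν) ~ w = ∃[ p ] ∃[ σ ] ∃[ μ ]
        (A ⊢ U ⟦ p ⟧≡ σ × τ ≡ f σ ++ μ × length ν ≡ c × w ≡ word p (f σ) ν μ)

      same-program : ∀ {p p′ σ σ′ ω ω′} → A ⊢ U ⟦ p ⟧≡ σ → A ⊢ U ⟦ p′ ⟧≡ σ′ → p ++ ω ≡ p′ ++ ω′ → p ≡ p′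
      same-program {p} {p′} d d′ eq with ≤-total (length p) (length p′)
      ... | inj₁ le = U-pf p p′ (_ , d) (_ , d′) (≼-linear (subst (p ≼_) eq (≼-++ p)) (≼-++ p′) le)
      ... | inj₂ le = sym (U-pf p′ p (_ , d′) (_ , d) (≼-linear (≼-++ p′) (subst (p ≼_) eq (≼-++ p)) le))

      injective : ∀ {x x′ w} → x ~ w → x′ ~ w → x ≡ x′
      injective {τ , ν} {τ′ , ν′} (p , σ , μ , d , τ≡ , len , w≡) (p′ , σ′ , μ′ , d′ , τ′≡ , len′ , w≡′)
        -- Decoding `w`: prefix-freeness recovers the program, determinism its output and with it
        -- the size of the filler block; the next `c` bits are `ν` and the rest is `μ`.
        with refl ← same-program {p} {p′} {σ} {σ′} d d′ (trans (sym w≡) w≡′)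
        with refl ← enc-injective {σ} {σ′} (⇓-deterministic d d′)
        with refl , refl ← ++-injective ν ν′ (trans len (sym len′))
               (++-cancelˡ (replicate (length (f σ) ∸ (length p + c)) false) _ _
                 (++-cancelˡ p _ _ (trans (sym w≡) w≡′)))
        = cong (_, ν) (trans τ≡ (sym τ′≡))

      image : ∀ {x} → x ∈ˡ cartesianProduct F (strings c) → ∃[ w ] (w ∈ˡ strings N × x ~ w)
      image {τ , ν} x∈ with τ∈ , ν∈ ← ∈-cartesianProduct⁻ F (strings c) x∈
        with refl , ρ , inW , ρ≼τ ← All.lookup all τ∈
        with p , σ , d , refl , short ← test-sound c ρ inW
        with μ , refl ← ≼⇒++ ρ≼τ
        = w , subst (λ n → w ∈ˡ strings n) length-w (∈-strings w) , p , σ , μ , d , refl , len , refl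
        where
        w = word p (f σ) ν μ
        len = ∈-strings⁻ c ν∈
        gap = length (f σ) ∸ (length p + c)
        length-w : length w ≡ length (f σ ++ μ)
        length-w = begin-equality
          length w
            ≡⟨ length-++ p ⟩
          length p + length (replicate gap false ++ ν ++ μ)
            ≡⟨ cong (length p +_) (trans (length-++ (replicate gap false))
                 (cong₂ _+_ (length-replicate gap) (trans (length-++ ν) (cong (_+ length μ) len)))) ⟩
          length p + (gap + (c + length μ))
            ≡⟨ cong (length p +_) (trans (sym (+-assoc gap c _)) (trans (cong (_+ length μ) (+-comm gap c)) (+-assoc c gap _))) ⟩
          length p + (c + (gap + length μ))
            ≡⟨ +-assoc (length p) c _ ⟨
          length p + c + (gap + length μ)
            ≡⟨ +-assoc (length p + c) gap _ ⟨
          length p + c + gap + length μ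
            ≡⟨ cong (_+ length μ) (m+[n∸m]≡n short) ⟩
          length (f σ) + length μ
            ≡⟨ length-++ (f σ) ⟨
          length (f σ ++ μ) ∎

-- A test yields compression

sumBelow-cong : ∀ {f g} n → (∀ i → i < n → f i ≡ g i) → sumBelow f n ≡ sumBelow g n
sumBelow-cong zero    _  = refl
sumBelow-cong (suc n) eq = cong₂ _+_ (eq n ≤-refl) (sumBelow-cong n λ i i< → eq i (m<n⇒m<1+n i<))

sumBelow-* : ∀ f c n → sumBelow (λ i → f i * c) n ≡ sumBelow f n * c
sumBelow-* f c zero    = refl
sumBelow-* f c (suc n) = trans (cong (f n * c +_) (sumBelow-* f c n)) (sym (*-distribʳ-+ c (f n) _))

sumBelow-mono : ∀ f {m n} → m ≤ n → sumBelow f m ≤ sumBelow f n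
sumBelow-mono f {m} {zero}  z≤n = z≤n
sumBelow-mono f {m} {suc n} le with m≤n⇒m<n∨m≡n le
... | inj₁ (s≤s le′) = ≤-trans (sumBelow-mono f le′) (m≤n+m _ (f n))
... | inj₂ refl      = ≤-refl

module _ (A : Oracle) where
  open Computability A
  open Evaluation A

  -- The approximation of a test by clopen sets: τ is hit when a prefix of τ is enumerated within length τ steps,
  -- and the minimal strings that are hit form a decidable prefix-free set generating the same open set.
  module MinimalHits (e : Code 2) where

    hits : ℕ → String → Bool
    hits n τ = anyBelow (λ j → not (isZero (eval e (length τ) (n ∷ enc (pad τ ↾ j) ∷ [])))) (suc (length τ))

    minimal : ℕ → String → Bool
    minimal n τ = hits n τ ∧ not (anyBelow (λ i → hits n (pad τ ↾ i)) (length τ))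

    -- The measure of the minimal hits that precede τ in the numbering, in units of 2 ^ (- length τ).
    rank : ℕ → String → ℕ
    rank n τ = sumBelow (λ k → bit (minimal n (dec k)) * 2 ^ (length τ ∸ length (dec k))) (enc τ)

    private
      variable
        m : ℕ
        Γ : Ctx m

    abstract
      hitsB : ∀ {N S} → Computable Γ nat N → Computable Γ str S → Computable Γ bool (λ γ → hits (N γ) (S γ))
      hitsB n s = anyBelowB (sucN (lengthN s)) (notB (isZeroB (call (evalN e)
        (lengthN (wk s) ∷ wk n ∷ encN (pad-↾S (wk s) (var 0F)) ∷ []))))

      minimalB : ∀ {N S} → Computable Γ nat N → Computable Γ str S → Computable Γ bool (λ γ → minimal (N γ) (S γ))
      minimalB n s = hitsB n s ∧B notB (anyBelowB (lengthN s) (hitsB (wk n) (pad-↾S (wk s) (var 0F))))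

      rankN : ∀ {N S} → Computable Γ nat N → Computable Γ str S → Computable Γ nat (λ γ → rank (N γ) (S γ))
      rankN n s = sumBelowN (encN s) (bitN (minimalB (wk n) (decS (var 0F)))
        *N 2^N (lengthN (wk s) ∸N lengthN (decS (var 0F))))

    hits⇒W : ∀ n τ → hits n τ ≡ true → ∃[ σ ] (W[ A , e ] n σ × σ ≼ τ)
    hits⇒W n τ hit with j , s≤s j≤ , pos ← anyBelow⁻ _ (suc (length τ)) hit
      = pad τ ↾ j , positive (pad τ ↾ j) _ refl pos , subst (pad τ ↾ j ≼_) (≺-pad τ) (↾-mono-≼ (pad τ) j≤)
      where
      positive : ∀ σ r → eval e (length τ) (n ∷ enc σ ∷ []) ≡ r → not (isZero r) ≡ true → W[ A , e ] n σ
      positive σ (suc r) eq _ = r , eval-sound e (length τ) _ eq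

    cover⇒hits : ∀ n X → X ∈⟦ W[ A , e ] n ⟧ → ∃[ L ] hits n (X ↾ L) ≡ true
    cover⇒hits n X (σ , σ≺X , _ , d) with s₀ , h ← eval-complete d = L , hit
      where
      -- The length of the prefix doubles as the evaluation bound, so it must both contain `σ` and
      -- reach the stage `s₀`.
      L = s₀ ⊔ length σ
      len : length (X ↾ L) ≡ L
      len = length-↾ X L
      σ≡ : pad (X ↾ L) ↾ length σ ≡ σ
      σ≡ = trans (↾-cong-≼ (pad (X ↾ L)) X (m≤n⊔m s₀ (length σ))
                   (trans (cong (pad (X ↾ L) ↾_) (sym len)) (≺-pad (X ↾ L)))) σ≺X
      hit : hits n (X ↾ L) ≡ true
      hit = anyBelow⁺ _ {length σ} (s≤s (subst (length σ ≤_) (sym len) (m≤n⊔m s₀ (length σ))))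
        (cong (not ∘ isZero) (trans (cong₂ (λ s τ → eval e s (n ∷ enc τ ∷ [])) len σ≡)
          (h L (m≤m⊔n s₀ (length σ)))))

    least-hit : ∀ n X L → hits n (X ↾ L) ≡ true → ∃[ L′ ] minimal n (X ↾ L′) ≡ true
    least-hit n X = λ L → go L L ≤-refl
      where
      go : ∀ k L → L ≤ k → hits n (X ↾ L) ≡ true → ∃[ L′ ] minimal n (X ↾ L′) ≡ true
      go k L L≤k hit with anyBelow (λ i → hits n (pad (X ↾ L) ↾ i)) (length (X ↾ L)) in some
      ... | false = L , ∧⁺ hit (cong not some)
      ... | true with i , i< , hit′ ← anyBelow⁻ _ (length (X ↾ L)) some
        with k
      ...   | zero  = contradiction (<-≤-trans (subst (i <_) (length-↾ X L) i<) L≤k) λ ()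
      ...   | suc k = go k i (≤-pred (<-≤-trans (subst (i <_) (length-↾ X L) i<) L≤k))
        (trans (cong (hits n) (sym prefix≡)) hit′)
        where
        prefix≡ : pad (X ↾ L) ↾ i ≡ X ↾ i
        prefix≡ = ↾-cong-≼ (pad (X ↾ L)) X (<⇒≤ (subst (i <_) (length-↾ X L) i<))
          (trans (cong (pad (X ↾ L) ↾_) (sym (length-↾ X L))) (≺-pad (X ↾ L)))

    cover⇒minimal : ∀ n X → X ∈⟦ W[ A , e ] n ⟧ → ∃[ L ] minimal n (X ↾ L) ≡ true
    cover⇒minimal n X cov with L , hit ← cover⇒hits n X cov = least-hit n X L hit

    minimal-prefixFree : ∀ n {σ τ} → minimal n σ ≡ true → minimal n τ ≡ true → σ ≼ τ → σ ≡ τ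
    minimal-prefixFree n {σ} {τ} σ-min τ-min σ≼τ with length σ <? length τ
    ... | no ¬lt = ≼∧length≥⇒≡ σ≼τ (≮⇒≥ ¬lt)
    ... | yes lt = ⊥-elim (true≢false
      (anyBelow⁺ (λ i → hits n (pad τ ↾ i)) lt
        (trans (cong (hits n) (≼-≺-trans {X = pad τ} σ≼τ (≺-pad τ))) (proj₁ (∧⁻ σ-min))))
      (not⁻ (proj₂ (∧⁻ {hits n τ} τ-min))))

    module _ (e-test : MLTest A e) (n : ℕ) where

      module _ (N : ℕ) where

        -- Listing the strings of length `N` above each minimal hit turns the weighted sum of `rank`
        -- into the size of a set, to which the measure bound of the test applies. With
        -- `N = length τ`, all indices up to `enc τ` satisfy `length (dec k) ≤ N`.
        cylinder : ℕ → List String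
        cylinder k = if minimal n (dec k) then map (dec k ++_) (strings (N ∸ length (dec k))) else []

        cylinders : ℕ → List String
        cylinders zero    = []
        cylinders (suc k) = cylinder k ++ cylinders k

        length-cylinder : ∀ k → length (cylinder k) ≡ bit (minimal n (dec k)) * 2 ^ (N ∸ length (dec k))
        length-cylinder k with minimal n (dec k)
        ... | false = refl
        ... | true  = trans (length-map _ (strings (N ∸ length (dec k))))
                            (trans (length-strings (N ∸ length (dec k))) (sym (+-identityʳ _)))

        length-cylinders : ∀ k → length (cylinders k) ≡
                           sumBelow (λ k → bit (minimal n (dec k)) * 2 ^ (N ∸ length (dec k))) k
        length-cylinders zero    = refl
        length-cylinders (suc k) = trans (length-++ (cylinder k)) (cong₂ _+_ (length-cylinder k) (length-cylinders k))

        ∈-cylinder : ∀ k {τ} → τ ∈ˡ cylinder k →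
                     minimal n (dec k) ≡ true × dec k ≼ τ × (length (dec k) ≤ N → length τ ≡ N)
        ∈-cylinder k τ∈ with minimal n (dec k)
        ... | true with μ , μ∈ , refl ← ∈-map⁻ (dec k ++_) τ∈ = refl , ≼-++ (dec k) , λ le →
          trans (length-++ (dec k)) (trans (cong (length (dec k) +_) (∈-strings⁻ _ μ∈)) (m+[n∸m]≡n le))

        ∈-cylinders : ∀ k {τ} → τ ∈ˡ cylinders k → ∃[ i ] (i < k × τ ∈ˡ cylinder i)
        ∈-cylinders (suc k) τ∈ with ∈-++⁻ (cylinder k) τ∈
        ... | inj₁ τ∈k = k , ≤-refl , τ∈k
        ... | inj₂ τ∈< with i , i< , τ∈i ← ∈-cylinders k τ∈< = i , m<n⇒m<1+n i< , τ∈i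

        cylinder-unique : ∀ k → Unique (cylinder k)
        cylinder-unique k with minimal n (dec k)
        ... | false = []
        ... | true  = Uniqueₚ.map⁺ (++-cancelˡ (dec k) _ _) (strings-unique (N ∸ length (dec k)))

        cylinders-unique : ∀ k → Unique (cylinders k)
        cylinders-unique zero    = []
        cylinders-unique (suc k) = Uniqueₚ.++⁺ (cylinder-unique k) (cylinders-unique k) λ (p , q) → disjoint p q
          where
          disjoint : ∀ {τ} → τ ∈ˡ cylinder k → τ ∈ˡ cylinders k → ⊥
          disjoint τ∈ τ∈< with i , i< , τ∈i ← ∈-cylinders k τ∈<
            with k-min , k≼ , _ ← ∈-cylinder k τ∈
            with i-min , i≼ , _ ← ∈-cylinder i τ∈i
            = <-irrefl (trans (sym (enc-dec i)) (trans (cong enc i≡k) (enc-dec k))) i<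
            where
            i≡k : dec i ≡ dec k
            i≡k with ≤-total (length (dec i)) (length (dec k))
            ... | inj₁ le = minimal-prefixFree n i-min k-min (≼-linear i≼ k≼ le)
            ... | inj₂ le = sym (minimal-prefixFree n k-min i-min (≼-linear k≼ i≼ le))

      -- The last summand belongs to `τ` itself, whose interval has length 1 in units of
      -- `2 ^ (- length τ)`.
      sum-up-to : ∀ τ → minimal n τ ≡ true →
                  sumBelow (λ k → bit (minimal n (dec k)) * 2 ^ (length τ ∸ length (dec k))) (suc (enc τ)) ≡ 1 + rank n τ
      sum-up-to τ τ-min = cong (_+ rank n τ)
        (trans (cong (λ σ → bit (minimal n σ) * 2 ^ (length τ ∸ length σ)) (dec-enc τ))
               (cong₂ (λ b i → bit b * 2 ^ i) τ-min (n∸n≡0 (length τ))))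

      -- The cylinders of the minimal hits up to and including `τ` are disjoint and lie in component
      -- `n`, of measure at most `2 ^ (- n)`. This is the room that permits scaling all intervals up
      -- by `2 ^ n`.
      rank-bound : ∀ τ → minimal n τ ≡ true → (1 + rank n τ) * 2 ^ n ≤ 2 ^ length τ
      rank-bound τ τ-min = subst (λ l → l * 2 ^ n ≤ 2 ^ N)
        (trans (length-cylinders N (suc (enc τ))) (sum-up-to τ τ-min))
        (e-test n N (cylinders N (suc (enc τ))) (cylinders-unique N (suc (enc τ))) (All.tabulate inside))
        where
        N = length τ
        inside : ∀ {υ} → υ ∈ˡ cylinders N (suc (enc τ)) → length υ ≡ N × ∃[ σ ] (W[ A , e ] n σ × σ ≼ υ)
        inside υ∈ with k , s≤s k≤ , υ∈k ← ∈-cylinders N (suc (enc τ)) υ∈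
          with k-min , k≼ , len ← ∈-cylinder N k υ∈k
          with σ , w , σ≼ ← hits⇒W n (dec k) (proj₁ (∧⁻ k-min))
          = len (length-dec≤ τ k≤) , σ , w , ≼-trans σ≼ k≼

      -- The sum for `υ` contains all the terms up to that of `τ`. As lengths do not decrease along
      -- the numbering, passing to the finer unit of `υ` multiplies each of these by the same power
      -- of 2.
      rank-gap : ∀ τ υ → minimal n τ ≡ true → enc τ < enc υ →
                 (1 + rank n τ) * 2 ^ (length υ ∸ length τ) ≤ rank n υ
      rank-gap τ υ τ-min lt = begin
        (1 + rank n τ) * c                         ≡⟨ cong (_* c) (sum-up-to τ τ-min) ⟨
        sumBelow (weight τ) (suc (enc τ)) * c      ≡⟨ sumBelow-* (weight τ) c (suc (enc τ)) ⟨
        sumBelow (λ k → weight τ k * c) (suc (enc τ)) ≡⟨ sumBelow-cong (suc (enc τ)) rescale ⟩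
        sumBelow (weight υ) (suc (enc τ))          ≤⟨ sumBelow-mono (weight υ) lt ⟩
        rank n υ                                   ∎
        where
        open ≤-Reasoning
        c = 2 ^ (length υ ∸ length τ)
        weight : String → ℕ → ℕ
        weight τ k = bit (minimal n (dec k)) * 2 ^ (length τ ∸ length (dec k))
        τ≤υ : length τ ≤ length υ
        τ≤υ = enc<⇒length≤ τ υ lt
        rescale : ∀ k → k < suc (enc τ) → weight τ k * c ≡ weight υ k
        rescale k (s≤s k≤) = trans (*-assoc b _ c) (cong (b *_)
          (trans (sym (^-distribˡ-+-* 2 (length τ ∸ length (dec k)) (length υ ∸ length τ))) (cong (2 ^_) exponent)))
          where
          b = bit (minimal n (dec k))
          k≤τ = length-dec≤ τ k≤
          exponent : (length τ ∸ length (dec k)) + (length υ ∸ length τ) ≡ length υ ∸ length (dec k)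
          exponent = trans (+-comm (length τ ∸ length (dec k)) _)
            (trans (sym (+-∸-assoc (length υ ∸ length τ) k≤τ)) (cong (_∸ length (dec k)) (m∸n+n≡m τ≤υ)))

      -- q is the code of τ: the interval of q is that of the rank of τ, scaled up by 2 ^ n.
      record Encodes (q τ : String) : Set where
        constructor encodes
        field
          isMinimal : minimal n τ ≡ true
          hasLength : length q + n ≡ length τ
          hasValue  : val q ≡ rank n τ
      open Encodes

      codes-exist : ∀ τ → minimal n τ ≡ true → ∃[ q ] Encodes q τ
      codes-exist τ τ-min = let q , len , val≡ = binary (length τ ∸ n) (rank n τ) rank< in
        q , encodes τ-min (trans (cong (_+ n) len) (m∸n+n≡m n≤)) val≡
        where
        open ≤-Reasoning
        -- The cylinder of a string shorter than `n` would alone have measure above `2 ^ (- n)`.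
        n≤ : n ≤ length τ
        n≤ with n ≤? length τ
        ... | yes le = le
        ... | no ¬le = contradiction (begin-strict
          2 ^ length τ          <⟨ ^-monoʳ-< 2 (s≤s (s≤s z≤n)) (≰⇒> ¬le) ⟩
          2 ^ n                 ≤⟨ m≤m+n (2 ^ n) _ ⟩
          (1 + rank n τ) * 2 ^ n ≤⟨ rank-bound τ τ-min ⟩
          2 ^ length τ          ∎) (<-irrefl refl)
        rank< : rank n τ < 2 ^ (length τ ∸ n)
        rank< = *-cancelʳ-≤ (1 + rank n τ) _ (2 ^ n) {{m^n≢0 2 n}} (begin
          (1 + rank n τ) * 2 ^ n          ≤⟨ rank-bound τ τ-min ⟩
          2 ^ length τ                    ≡⟨ cong (2 ^_) (m∸n+n≡m n≤) ⟨
          2 ^ (length τ ∸ n + n)          ≡⟨ ^-distribˡ-+-* 2 (length τ ∸ n) n ⟩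
          2 ^ (length τ ∸ n) * 2 ^ n      ∎)

      -- By `val-≼` an extension of `q` has its value inside the interval of `q`, while by
      -- `rank-gap` the interval of a later hit starts beyond it. Codes and hits differ in length by
      -- the same `n`, so both estimates use the same scale.
      codes-disjoint : ∀ {q q′ τ τ′} → Encodes q τ → Encodes q′ τ′ → q ≼ q′ → enc τ ≮ enc τ′
      codes-disjoint {q} {q′} {τ} {τ′} (encodes τ-min len val≡) (encodes _ len′ val≡′) q≼ lt = <-irrefl refl (begin-strict
        val q′                                               <⟨ val-≼ q≼ ⟩
        (1 + val q) * 2 ^ (length q′ ∸ length q)             ≡⟨ cong₂ (λ v i → (1 + v) * 2 ^ i) val≡ shift ⟩
        (1 + rank n τ) * 2 ^ (length τ′ ∸ length τ)          ≤⟨ rank-gap τ τ′ τ-min lt ⟩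
        rank n τ′                                            ≡⟨ val≡′ ⟨
        val q′                                               ∎)
        where
        open ≤-Reasoning
        shift : length q′ ∸ length q ≡ length τ′ ∸ length τ
        shift = trans (sym ([m+n]∸[m+o]≡n∸o n (length q′) (length q)))
          (cong₂ _∸_ (trans (+-comm n _) len′) (trans (+-comm n _) len))

      codes-prefixFree : ∀ {q q′ τ τ′} → Encodes q τ → Encodes q′ τ′ → q ≼ q′ → τ ≡ τ′ × q ≡ q′
      codes-prefixFree {q} {q′} {τ} {τ′} E E′ q≼ with <-cmp (enc τ) (enc τ′)
      ... | tri< lt _ _ = contradiction lt (codes-disjoint E E′ q≼)
      ... | tri≈ _ eq _ = enc-injective {τ} {τ′} eq , ≼∧length≥⇒≡ q≼ (≤-reflexive (+-cancelʳ-≡ n _ _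
        (trans (hasLength E′) (trans (cong length (sym (enc-injective {τ} {τ′} eq))) (sym (hasLength E))))))
      -- The earlier `τ′` is at most as long as `τ`, hence `q′` at most as long as `q`; so `q ≼ q′`
      -- forces equality and the roles can be exchanged.
      ... | tri> _ _ gt = contradiction gt (codes-disjoint E′ E (subst (_≼ q) q≡ ≼-refl))
        where
        q≡ : q ≡ q′
        q≡ = ≼∧length≥⇒≡ q≼ (+-cancelʳ-≤ n _ _
          (subst₂ _≤_ (sym (hasLength E′)) (sym (hasLength E)) (enc<⇒length≤ τ′ τ gt)))

-- The prefix-free machine of a test

block : ℕ → String → String
block n q = replicate n false ++ true ∷ q

-- The unary part is self-delimiting: the first `true` marks its end.
block-≼ : ∀ m n {q q′} → block m q ≼ block n q′ → m ≡ n × q ≼ q′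
block-≼ zero    zero    (_ ∷ p)  = refl , p
block-≼ zero    (suc n) (() ∷ _)
block-≼ (suc m) zero    (() ∷ _)
block-≼ (suc m) (suc n) (_ ∷ p)  with refl , q≼ ← block-≼ m n p = refl , q≼

length-block : ∀ n q → length (block n q) ≡ suc (n + length q)
length-block zero    q = refl
length-block (suc n) q = cong suc (length-block n q)

module _ (A : Oracle) where
  open Computability A
  open Evaluation A

  module Compression (f : String → String) (fᶜ : Computable (str ∷ []) str (λ (σ , _) → f σ))
    (G : String → Bool) (Gᶜ : Computable (str ∷ []) bool (λ (σ , _) → G σ))
    (e : Code 2) (e-test : MLTest A e) where

    open MinimalHits A e

    -- A code for component `2 * n` saves `2 * n` bits; the unary part of the block spends `n + 1`
    -- of them, which leaves a net saving of `n - 1`.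
    level : ℕ → ℕ
    level n = 2 * n

    -- The machine maps the block n q, where q codes a minimal hit τ of the component 2 n of the test,
    -- to a string σ in G with f σ ≡ τ.
    accepts : Env (str ∷ str ∷ []) → Bool
    accepts (σ , p , _) = G σ
      ∧ (length p ≡ᵇ suc (leading p + length (payload p)))
      ∧ minimal (level (leading p)) (f σ)
      ∧ (length (payload p) + level (leading p) ≡ᵇ length (f σ))
      ∧ (val (payload p) ≡ᵇ rank (level (leading p)) (f σ))

    abstract
      acceptsB : Computable (str ∷ str ∷ []) bool accepts
      acceptsB = call Gᶜ (var 0F ∷ [])
        ∧B (lengthN (var 1F) ≡ᵇB sucN (leadingN (var 1F) +N lengthN (payloadS (var 1F))))
        ∧B minimalB levelN fS
        ∧B (lengthN (payloadS (var 1F)) +N levelN ≡ᵇB lengthN fS)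
        ∧B (valN (payloadS (var 1F)) ≡ᵇB rankN levelN fS)
        where
        levelN : Computable (str ∷ str ∷ []) nat (λ (_ , p , _) → level (leading p))
        levelN = lit 2 *N leadingN (var 1F)
        fS : Computable (str ∷ str ∷ []) str (λ (σ , _) → f σ)
        fS = call fᶜ (var 0F ∷ [])

    machine : Code 1
    machine = search acceptsB

    accepts⁻ : ∀ σ p → accepts (σ , p , tt) ≡ true →
               ∃[ n ] ∃[ q ] (p ≡ block n q × G σ ≡ true × Encodes e-test (level n) q (f σ))
    accepts⁻ σ p acc
      with g , acc ← ∧⁻ {G σ} acc
      with split , acc ← ∧⁻ {length p ≡ᵇ suc (leading p + length (payload p))} acc
      with minim , acc ← ∧⁻ {minimal (level (leading p)) (f σ)} acc
      with len , value ← ∧⁻ {length (payload p) + level (leading p) ≡ᵇ length (f σ)} acc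
      = leading p , payload p , block-split p (≡ᵇ⁻ _ _ split) , g ,
        encodes minim (≡ᵇ⁻ _ _ len) (≡ᵇ⁻ _ _ value)

    accepts⁺ : ∀ σ n q → G σ ≡ true → Encodes e-test (level n) q (f σ) →
               accepts (σ , block n q , tt) ≡ true
    accepts⁺ σ n q g (encodes minim len value)
      rewrite leading-block n q | payload-block n q =
        ∧⁺ g (∧⁺ (≡ᵇ⁺ (length-block n q)) (∧⁺ minim (∧⁺ (≡ᵇ⁺ len) (≡ᵇ⁺ value))))

    machine-prefixFree : PrefixFree A machine
    machine-prefixFree p p′ (y , d) (y′ , d′) p≼
      with n , q , refl , _ , E ← accepts⁻ (dec y) p (search-sound acceptsB (p , tt) d)
      with n′ , q′ , refl , _ , E′ ← accepts⁻ (dec y′) p′ (search-sound acceptsB (p′ , tt) d′)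
      with refl , q≼ ← block-≼ n n′ p≼
      = cong (block n) (proj₂ (codes-prefixFree e-test (level n) E E′ q≼))

    -- The search may stop at a string other than `σ`. Since a code belongs to one minimal hit only,
    -- that string still has the same image under `f`.
    machine-compresses : ∀ n σ → G σ ≡ true → minimal (level n) (f σ) ≡ true →
                         ∃[ p ] ∃[ σ′ ] (A ⊢ machine ⟦ p ⟧≡ σ′ × G σ′ ≡ true × f σ′ ≡ f σ
                           × length p + n ≡ suc (length (f σ)))
    machine-compresses n σ g minim
      with q , E ← codes-exist e-test (level n) (f σ) minim
      with σ′ , d , acc ← search-complete acceptsB (block n q , tt) {σ} (accepts⁺ σ n q g E)
      with n′ , q′ , eq , g′ , E′ ← accepts⁻ σ′ (block n q) acc
      with refl , q≼ ← block-≼ n n′ (subst (block n q ≼_) eq ≼-refl)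
      = block n q , σ′ , d , g′ , sym (proj₁ (codes-prefixFree e-test (level n) E E′ q≼)) ,
        trans (cong (_+ n) (length-block n q)) (cong suc (trans (arith n (length q)) (Encodes.hasLength E)))
      where
      arith : ∀ n l → n + l + n ≡ l + 2 * n
      arith = solve-∀

    compress : ∀ R → (∀ n → R ∈⟦ W[ A , e ] n ⟧) → (∀ L → ∃[ σ ] (G σ ≡ true × f σ ≡ R ↾ L)) →
               ∀ n → ∃[ p ] ∃[ σ ] (A ⊢ machine ⟦ p ⟧≡ σ × G σ ≡ true × f σ ≺ R
                 × length p + n ≡ suc (length (f σ)))
    compress R cover onto n =
      let L , minim = cover⇒minimal (level n) R (cover (level n)) in
      from-hit L (onto L) minim
      where
      from-hit : ∀ L → ∃[ σ ] (G σ ≡ true × f σ ≡ R ↾ L) → minimal (level n) (R ↾ L) ≡ true →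
                 ∃[ p ] ∃[ σ ] (A ⊢ machine ⟦ p ⟧≡ σ × G σ ≡ true × f σ ≺ R
                   × length p + n ≡ suc (length (f σ)))
      from-hit L (σ , g , fσ≡) minim =
        let p , σ′ , d , g′ , fσ′≡ , len =
              machine-compresses n σ g (subst (λ τ → minimal (level n) τ ≡ true) (sym fσ≡) minim)
        in p , σ′ , d , g′ , subst (_≺ R) (sym (trans fσ′≡ fσ≡)) (↾-≺ R L) ,
           trans len (cong (suc ∘ length) (sym fσ′≡))

  -- Schnorr's criterion, transported along f.
  incompressible⇒random : ∀ {U} → Optimal A U →
    (f : String → String) → Computable (str ∷ []) str (λ (σ , _) → f σ) →
    (G : String → Bool) → Computable (str ∷ []) bool (λ (σ , _) → G σ) →
    ∀ R c → (∀ σ q → G σ ≡ true → f σ ≺ R → A ⊢ U ⟦ q ⟧≡ σ → length (f σ) ≤ length q + c) →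
    (∀ L → ∃[ σ ] (G σ ≡ true × f σ ≡ R ↾ L)) →
    MLR A R
  incompressible⇒random {U} (_ , optimal) f fᶜ G Gᶜ R c incompressible onto e e-test cover =
    contradict (C.machine) C.machine-prefixFree (C.compress R cover onto)
    where
    module C = Compression f fᶜ G Gᶜ e e-test
    open ≤-Reasoning
    arith : ∀ l k c → 2 + (l + k + c) ≡ l + (2 + (k + c))
    arith = solve-∀
    contradict : ∀ M → PrefixFree A M →
                 (∀ n → ∃[ p ] ∃[ σ ] (A ⊢ M ⟦ p ⟧≡ σ × G σ ≡ true × f σ ≺ R
                   × length p + n ≡ suc (length (f σ)))) → ⊥
    contradict M M-pf compress
      with k , simulate ← optimal M M-pf
      -- In `2 + (k + c)`, `k` pays for the simulation by `U` and `c` for the assumed constant; of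
      -- the remaining 2, one offsets the `suc` in the length equation of `compress` and one makes
      -- the inequality strict.
      with p , σ , d , g , fσ≺R , len ← compress (2 + (k + c))
      with q , d′ , q≤ ← simulate p σ d
      = <-irrefl refl (begin-strict
      1 + length (f σ)            ≤⟨ s≤s (incompressible σ q g fσ≺R d′) ⟩
      1 + (length q + c)          ≤⟨ s≤s (+-monoˡ-≤ c q≤) ⟩
      1 + (length p + k + c)      <⟨ ≤-reflexive (arith (length p) k c) ⟩
      length p + (2 + (k + c))    ≡⟨ len ⟩
      1 + length (f σ)            ∎)

-- Random extensions of a string

infixr 5 _⁺⁺_

_⁺⁺_ : String → Seq → Seq
([]      ⁺⁺ Y) i       = Y i
((b ∷ σ) ⁺⁺ Y) zero    = b
((b ∷ σ) ⁺⁺ Y) (suc i) = (σ ⁺⁺ Y) i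

⁺⁺-↾ : ∀ σ Y n → (σ ⁺⁺ Y) ↾ (length σ + n) ≡ σ ++ Y ↾ n
⁺⁺-↾ []      Y n = refl
⁺⁺-↾ (b ∷ σ) Y n = cong (b ∷_) (⁺⁺-↾ σ Y n)

module _ (em : ExcludedMiddle 0ℓ) where

  module _ (V : Pred String 0ℓ) where

    -- Covering at a finite stage. Staying uncovered is enough to avoid the open set, since
    -- membership in it is witnessed by a finite prefix.
    Covered : Pred String 0ℓ
    Covered σ = ∃[ N ] ∀ μ → length μ ≡ N → ∃[ υ ] (V υ × υ ≼ σ ++ μ)

    covered-children : ∀ σ → Covered (σ ∷ʳ false) → Covered (σ ∷ʳ true) → Covered σ
    covered-children σ (M , c₀) (N , c₁) = suc (M ⊔ N) , cover
      where
      child : ∀ b K → K ≤ M ⊔ N → (∀ μ → length μ ≡ K → ∃[ υ ] (V υ × υ ≼ σ ∷ʳ b ++ μ)) →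
              ∀ μ → length μ ≡ M ⊔ N → ∃[ υ ] (V υ × υ ≼ σ ++ b ∷ μ)
      child b K K≤ c μ len
        with υ , v , υ≼ ← c (take K μ) (trans (length-take K μ) (m≤n⇒m⊓n≡m (subst (K ≤_) (sym len) K≤)))
        = υ , v , subst (υ ≼_) eq (≼-trans υ≼ (≼-++ (σ ∷ʳ b ++ take K μ)))
        where
        eq : (σ ∷ʳ b ++ take K μ) ++ drop K μ ≡ σ ++ b ∷ μ
        eq = trans (++-assoc (σ ∷ʳ b) _ _) (trans (++-assoc σ _ _) (cong (λ τ → σ ++ b ∷ τ) (take++drop≡id K μ)))
      cover : ∀ μ → length μ ≡ suc (M ⊔ N) → ∃[ υ ] (V υ × υ ≼ σ ++ μ)
      cover (false ∷ μ) len = child false M (m≤m⊔n M N) c₀ μ (suc-injective len)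
      cover (true  ∷ μ) len = child true  N (m≤n⊔m M N) c₁ μ (suc-injective len)

    -- A cover would give the open set measure at least `2 ^ (- length ρ)`, which exceeds
    -- `2 ^ (- c)`.
    small⇒¬Covered : ∀ {c} ρ → Measure V ≤2^- c → length ρ < c → ¬ Covered ρ
    small⇒¬Covered {c} ρ small lt (N , cover) = <-irrefl refl (begin-strict
      2 ^ (length ρ + N)                        <⟨ ^-monoʳ-< 2 (s≤s (s≤s z≤n)) (+-monoˡ-< N lt) ⟩
      2 ^ (c + N)                               ≡⟨ ^-distribˡ-+-* 2 c N ⟩
      2 ^ c * 2 ^ N                             ≡⟨ *-comm (2 ^ c) _ ⟩
      2 ^ N * 2 ^ c                             ≡⟨ cong (_* 2 ^ c) (trans (length-map (ρ ++_) (strings N)) (length-strings N)) ⟨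
      length (map (ρ ++_) (strings N)) * 2 ^ c  ≤⟨ small (length ρ + N) _
                                                     (Uniqueₚ.map⁺ (++-cancelˡ ρ _ _) (strings-unique N))
                                                     (All.tabulate λ τ∈ → extension (∈-map⁻ (ρ ++_) τ∈)) ⟩
      2 ^ (length ρ + N)                        ∎)
      where
      open ≤-Reasoning
      extension : ∀ {τ} → ∃[ μ ] (μ ∈ˡ strings N × τ ≡ ρ ++ μ) →
                  length τ ≡ length ρ + N × ∃[ υ ] (V υ × υ ≼ τ)
      extension (μ , μ∈ , refl) =
        trans (length-++ ρ) (cong (length ρ +_) (∈-strings⁻ N μ∈)) , cover μ (∈-strings⁻ N μ∈)

    -- By `covered-children` an uncovered string has an uncovered child. Excluded middle selects one
    -- at every step, starting from `ρ`.
    avoid : ∀ {c} ρ → Measure V ≤2^- c → length ρ < c → ∃[ R ] (ρ ≺ R × ¬ R ∈⟦ V ⟧)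
    avoid ρ small lt = R , ρ≺R , outside
      where
      choose : String → Bool
      choose σ = does (em {Covered (σ ∷ʳ false)})

      choose-¬Covered : ∀ σ → ¬ Covered σ → ¬ Covered (σ ∷ʳ choose σ)
      choose-¬Covered σ ¬cov with em {Covered (σ ∷ʳ false)}
      ... | yes c₀ = λ c₁ → ¬cov (covered-children σ c₀ c₁)
      ... | no ¬c₀ = ¬c₀

      path : ℕ → String
      path zero    = ρ
      path (suc n) = path n ∷ʳ choose (path n)

      path-¬Covered : ∀ n → ¬ Covered (path n)
      path-¬Covered zero    = small⇒¬Covered ρ small lt
      path-¬Covered (suc n) = choose-¬Covered (path n) (path-¬Covered n)

      Y : Seq
      Y n = choose (path n)

      path≡ : ∀ n → ρ ++ Y ↾ n ≡ path n
      path≡ zero    = ++-identityʳ ρ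
      path≡ (suc n) = trans (cong (ρ ++_) (↾-suc Y n))
        (trans (sym (++-assoc ρ (Y ↾ n) _)) (cong (_∷ʳ Y n) (path≡ n)))

      R : Seq
      R = ρ ⁺⁺ Y

      ρ≺R : ρ ≺ R
      ρ≺R = trans (cong (R ↾_) (sym (+-identityʳ _))) (trans (⁺⁺-↾ ρ Y 0) (++-identityʳ ρ))

      outside : ¬ R ∈⟦ V ⟧
      -- The node `path (length υ)` is at least as long as `υ`, so a prefix `υ` in `V` would cover
      -- it already with `N = 0`.
      outside (υ , υ≺R , v) = path-¬Covered (length υ) (0 , λ { [] _ → υ , v , υ≼ })
        where
        υ≼ : υ ≼ path (length υ) ++ []
        υ≼ = subst (υ ≼_) (trans (⁺⁺-↾ ρ Y (length υ)) (trans (path≡ (length υ)) (sym (++-identityʳ _))))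
          (≺⇒≼↾ R υ≺R (m≤n+m _ (length ρ)))

  -- A sequence outside one component of the test of compressible strings is incompressible up to a
  -- constant, hence random. The component `suc (length ρ)` is too small to fill the cylinder of
  -- `ρ`.
  random-extension : ∀ {A U} → Optimal A U → ∀ ρ → ∃[ R ] (ρ ≺ R × MLR A R)
  random-extension {A} {U} opt ρ =
    let R , ρ≺R , outside = avoid (W[ A , test ] c) ρ (test-measure c) ≤-refl in
    R , ρ≺R , incompressible⇒random A opt id (var 0F) (λ _ → true) trueB R c
      (λ σ q _ σ≺R d → ≮⇒≥ λ lt → outside (σ , σ≺R , test-complete c σ (q , σ , d , refl , <⇒≤ lt)))
      (λ L → R ↾ L , refl , refl)
    where
    open Computability A
    open CompressionTest A U (proj₁ opt) id (var 0F)
    c = suc (length ρ)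

-- Branching bits

take-↾ : ∀ X {j n} → j ≤ n → take j (X ↾ n) ≡ X ↾ j
take-↾ X z≤n      = refl
take-↾ X (s≤s le) = cong (X 0 ∷_) (take-↾ (X ∘ suc) le)

≺-∷ʳ⁺ : ∀ {σ R b} → σ ≺ R → R (length σ) ≡ b → σ ∷ʳ b ≺ R
≺-∷ʳ⁺ {σ} {R} {b} σ≺R eq = trans (cong (R ↾_) (trans (length-++ σ) (+-comm (length σ) 1)))
  (trans (↾-suc R (length σ)) (cong₂ _∷ʳ_ σ≺R eq))

≺-∷ʳ⁻ : ∀ {σ R b} → σ ∷ʳ b ≺ R → R (length σ) ≡ b
≺-∷ʳ⁻ {σ} {R} {b} ≺R = proj₂ (∷ʳ-injective (R ↾ length σ) σ
  (trans (sym (↾-suc R (length σ)))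
    (trans (cong (R ↾_) (sym (trans (length-++ σ) (+-comm (length σ) 1)))) ≺R)))

pointwise⇒≺ : ∀ σ R → (∀ i → i < length σ → R i ≡ pad σ i) → σ ≺ R
pointwise⇒≺ []      R eq = refl
pointwise⇒≺ (b ∷ σ) R eq = cong₂ _∷_ (eq 0 (s≤s z≤n)) (pointwise⇒≺ σ (R ∘ suc) λ i i< → eq (suc i) (s≤s i<))

flipLast-∷ʳ : ∀ σ b → flipLast (σ ∷ʳ b) ≡ σ ∷ʳ not b
flipLast-∷ʳ []          b = refl
flipLast-∷ʳ (a ∷ [])    b = refl
flipLast-∷ʳ (a ∷ c ∷ σ) b = cong (a ∷_) (flipLast-∷ʳ (c ∷ σ) b)

-- Brings `bitsUsed` and `θ`, both defined by `filter`, into the form of `length-branchBits`.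
length-filter-applyUpTo : ∀ {Q : Pred ℕ 0ℓ} (Q? : Decidable Q) g (p : ℕ → Bool) n →
  (∀ j → j < n → does (Q? (g j)) ≡ p j) →
  length (filter Q? (applyUpTo g n)) ≡ sumBelow (bit ∘ p) n
length-filter-applyUpTo Q? g p zero    eq = refl
length-filter-applyUpTo Q? g p (suc n) eq = begin
  length (filter Q? (applyUpTo g (suc n)))
    ≡⟨ cong (length ∘ filter Q?) (applyUpTo-∷ʳ g n) ⟨
  length (filter Q? (applyUpTo g n ∷ʳ g n))
    ≡⟨ cong length (filter-++ Q? (applyUpTo g n) _) ⟩
  length (filter Q? (applyUpTo g n) ++ filter Q? (g n ∷ []))
    ≡⟨ length-++ (filter Q? (applyUpTo g n)) ⟩
  length (filter Q? (applyUpTo g n)) + length (filter Q? (g n ∷ []))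
    ≡⟨ cong₂ _+_ (length-filter-applyUpTo Q? g p n λ j j< → eq j (m<n⇒m<1+n j<))
         (trans (singleton (g n)) (cong bit (eq n ≤-refl))) ⟩
  sumBelow (bit ∘ p) n + bit (p n)
    ≡⟨ +-comm _ (bit (p n)) ⟩
  bit (p n) + sumBelow (bit ∘ p) n ∎
  where
  open ≡-Reasoning
  singleton : ∀ x → length (filter Q? (x ∷ [])) ≡ bit (does (Q? x))
  singleton x with does (Q? x)
  ... | false = refl
  ... | true  = refl

module _ {T : Pred String 0ℓ} (T? : Decidable T) where

  branches : String → Bool
  branches σ = does (T? (σ ∷ʳ false)) ∧ does (T? (σ ∷ʳ true))

  branchBits : Seq → ℕ → String
  branchBits X zero    = []
  branchBits X (suc j) = if branches (X ↾ j) then branchBits X j ∷ʳ X j else branchBits X j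

  -- For σ on the tree, the bits of R consumed by any Ψ T? R that passes through σ.
  consumed : String → String
  consumed σ = branchBits (pad σ) (length σ)

  branchBits-cong : ∀ X Y n → X ↾ n ≡ Y ↾ n → branchBits X n ≡ branchBits Y n
  branchBits-cong X Y zero    _  = refl
  branchBits-cong X Y (suc n) eq
    with ini , last ← ∷ʳ-injective (X ↾ n) (Y ↾ n) (trans (sym (↾-suc X n)) (trans eq (↾-suc Y n)))
    = cong₂ (λ b s → if b then proj₁ s ∷ʳ proj₂ s else proj₁ s) (cong branches ini)
        (cong₂ _,_ (branchBits-cong X Y n ini) last)

  consumed-↾ : ∀ X n → consumed (X ↾ n) ≡ branchBits X n
  consumed-↾ X n = trans (cong (branchBits (pad (X ↾ n))) (length-↾ X n))
    (branchBits-cong (pad (X ↾ n)) X n (trans (cong (pad (X ↾ n) ↾_) (sym (length-↾ X n))) (≺-pad (X ↾ n))))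

  branchBits-step : ∀ X n → branchBits X n ≼ branchBits X (suc n)
  branchBits-step X n with branches (X ↾ n)
  ... | false = ≼-refl
  ... | true  = ≼-++ (branchBits X n)

  branchBits-mono : ∀ X {m n} → m ≤ n → branchBits X m ≼ branchBits X n
  branchBits-mono X {m} {n} le with m≤n⇒m<n∨m≡n le
  branchBits-mono X {m} {suc n} _ | inj₁ (s≤s le) = ≼-trans (branchBits-mono X le) (branchBits-step X n)
  branchBits-mono X {m} {m}     _ | inj₂ refl     = ≼-refl

  branchBits-comparable : ∀ X {m n} → length (branchBits X m) ≤ length (branchBits X n) →
                          branchBits X m ≼ branchBits X n
  branchBits-comparable X {m} {n} le with ≤-total m n
  ... | inj₁ m≤n = branchBits-mono X m≤n
  ... | inj₂ n≤m = subst (branchBits X m ≼_) (sym (≼∧length≥⇒≡ (branchBits-mono X n≤m) le)) ≼-refl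

  length-branchBits : ∀ X n → length (branchBits X n) ≡ sumBelow (λ j → bit (branches (X ↾ j))) n
  length-branchBits X zero    = refl
  length-branchBits X (suc n) with branches (X ↾ n)
  ... | false = length-branchBits X n
  ... | true  = trans (length-++ (branchBits X n))
    (trans (+-comm (length (branchBits X n)) 1) (cong suc (length-branchBits X n)))

  -- Each step adds at most one bit, so no length is skipped.
  branchBits-reach : ∀ X L n → L ≤ length (branchBits X n) → ∃[ m ] length (branchBits X m) ≡ L
  branchBits-reach X L zero    z≤n = 0 , refl
  branchBits-reach X L (suc n) le with L ≤? length (branchBits X n)
  ... | yes le′ = branchBits-reach X L n le′
  ... | no ¬le with branches (X ↾ n) in br
  ...   | false = contradiction le ¬le
  ...   | true  = suc n , trans (cong (λ b → length (if b then branchBits X n ∷ʳ X n else branchBits X n)) br)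
    (≤-antisym (≤-trans (≤-reflexive len) (≰⇒> ¬le)) le)
    where
    len : length (branchBits X n ∷ʳ X n) ≡ suc (length (branchBits X n))
    len = trans (length-++ (branchBits X n)) (+-comm (length (branchBits X n)) 1)

  bitsUsed-↾ : ∀ X n → bitsUsed T? (X ↾ n) ≡ length (branchBits X n)
  bitsUsed-↾ X n rewrite length-↾ X n = trans
    (length-filter-applyUpTo _ id (branches ∘ (X ↾_)) n
      λ j j< → cong branches (take-↾ X (<⇒≤ j<)))
    (sym (length-branchBits X n))

  -- As `X ↾ suc j` is on the tree, its sibling is on the tree exactly when `X ↾ j` branches.
  θ-↾ : ∀ X → (∀ n → T (X ↾ n)) → ∀ n → θ T? (X ↾ n) ≡ length (branchBits X n)
  θ-↾ X onTree n rewrite length-↾ X n = trans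
    (length-filter-applyUpTo _ suc (branches ∘ (X ↾_)) n sibling)
    (sym (length-branchBits X n))
    where
    sibling : ∀ j → j < n → does (T? (flipLast (take (suc j) (X ↾ n)))) ≡ branches (X ↾ j)
    sibling j j< rewrite take-↾ X j< | ↾-suc X j | flipLast-∷ʳ (X ↾ j) (X j)
      = case-bit (X j) (subst T (↾-suc X j) (onTree (suc j)))
      where
      case-bit : ∀ b → T (X ↾ j ∷ʳ b) → does (T? (X ↾ j ∷ʳ not b)) ≡ branches (X ↾ j)
      case-bit false t rewrite dec-true (T? (X ↾ j ∷ʳ false)) t = refl
      case-bit true  t rewrite dec-true (T? (X ↾ j ∷ʳ true)) t = sym (Boolₚ.∧-identityʳ _)

  nextBit-branch : ∀ R σ → branches σ ≡ true → nextBit T? R σ ≡ R (bitsUsed T? σ)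
  nextBit-branch R σ br with T? (σ ∷ʳ false) | T? (σ ∷ʳ true)
  ... | yes _ | yes _ = refl

  nextBit-single : ∀ R σ {b} → branches σ ≡ false → T (σ ∷ʳ b) → nextBit T? R σ ≡ b
  nextBit-single R σ {b} br t with T? (σ ∷ʳ false) | T? (σ ∷ʳ true)
  nextBit-single R σ {false} br t | yes _ | no _ = refl
  nextBit-single R σ {true}  br t | yes _ | no ¬t = contradiction t ¬t
  nextBit-single R σ {false} br t | no ¬t | yes _ = contradiction t ¬t
  nextBit-single R σ {true}  br t | no _  | yes _ = refl
  nextBit-single R σ {false} br t | no ¬t | no _ = contradiction t ¬t
  nextBit-single R σ {true}  br t | no _  | no ¬t = contradiction t ¬t

  -- At a node that does not branch, `nextBit` equals the label of any child on the tree; the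
  -- constant sequence supplied here is arbitrary.
  single-child : ∀ σ {a b} → branches σ ≡ false → T (σ ∷ʳ a) → T (σ ∷ʳ b) → a ≡ b
  single-child σ br ta tb =
    trans (sym (nextBit-single (λ _ → false) σ br ta)) (nextBit-single (λ _ → false) σ br tb)

  branchBits-suc-true : ∀ X n → branches (X ↾ n) ≡ true → branchBits X (suc n) ≡ branchBits X n ∷ʳ X n
  branchBits-suc-true X n br rewrite br = refl

  Ψ-initial-≗ : ∀ {R X} → Ψ T? R ≗ X → ∀ n → Ψ-initial T? R n ≡ X ↾ n
  Ψ-initial-≗         eq zero    = refl
  Ψ-initial-≗ {R} {X} eq (suc n) = trans (cong₂ _∷ʳ_ (Ψ-initial-≗ eq n) (eq n)) (sym (↾-suc X n))

  module _ (X : Seq) (onTree : ∀ n → T (X ↾ n)) (R : Seq) where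

    branchBits-≺ : Ψ T? R ≗ X → ∀ n → branchBits X n ≺ R
    branchBits-≺ eq zero    = refl
    branchBits-≺ eq (suc n) with branches (X ↾ n) in br
    ... | false = branchBits-≺ eq n
    ... | true  = ≺-∷ʳ⁺ {branchBits X n} {R} (branchBits-≺ eq n) (begin
      R (length (branchBits X n))       ≡⟨ cong R (bitsUsed-↾ X n) ⟨
      R (bitsUsed T? (X ↾ n))           ≡⟨ nextBit-branch R (X ↾ n) br ⟨
      nextBit T? R (X ↾ n)              ≡⟨ cong (nextBit T? R) (Ψ-initial-≗ eq n) ⟨
      Ψ T? R n                          ≡⟨ eq n ⟩
      X n                               ∎)
      where open ≡-Reasoning

    module _ (bits≺R : ∀ n → branchBits X n ≺ R) where

      nextBit-≡ : ∀ n → nextBit T? R (X ↾ n) ≡ X n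
      nextBit-≡ n with branches (X ↾ n) in br
      ... | false = nextBit-single R (X ↾ n) br (subst T (↾-suc X n) (onTree (suc n)))
      ... | true  = trans (nextBit-branch R (X ↾ n) br) (trans (cong R (bitsUsed-↾ X n))
        (≺-∷ʳ⁻ {branchBits X n} {R} (subst (_≺ R) (branchBits-suc-true X n br) (bits≺R (suc n)))))

      Ψ-initial-≡ : ∀ n → Ψ-initial T? R n ≡ X ↾ n
      Ψ-initial-≡ zero    = refl
      Ψ-initial-≡ (suc n) = trans (cong (λ σ → σ ∷ʳ nextBit T? R σ) (Ψ-initial-≡ n))
        (trans (cong (X ↾ n ∷ʳ_) (nextBit-≡ n)) (sym (↾-suc X n)))

      Ψ-≗ : Ψ T? R ≗ X
      Ψ-≗ n = trans (cong (nextBit T? R) (Ψ-initial-≡ n)) (nextBit-≡ n)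

      -- At a branching node `R` decides the next bit, and elsewhere only one child is on the tree.
      -- This identifies the strings output by programs as initial segments of `X`.
      agree : ∀ Y m → (∀ n → n ≤ m → T (Y ↾ n)) → branchBits Y m ≺ R → ∀ n → n ≤ m → Y ↾ n ≡ X ↾ n
      agree Y m Y-onTree Y≺R zero    _  = refl
      agree Y m Y-onTree Y≺R (suc n) lt = trans (↾-suc Y n) (trans (cong₂ _∷ʳ_ IH same) (sym (↾-suc X n)))
        where
        IH : Y ↾ n ≡ X ↾ n
        IH = agree Y m Y-onTree Y≺R n (<⇒≤ lt)
        same : Y n ≡ X n
        same with branches (X ↾ n) in br
        ... | false = single-child (X ↾ n) br
          (subst T (trans (↾-suc Y n) (cong (_∷ʳ Y n) IH)) (Y-onTree (suc n) lt))
          (subst T (↾-suc X n) (onTree (suc n)))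
        ... | true  = trans
          (sym (≺-∷ʳ⁻ {branchBits Y n} {R} (subst (_≺ R)
            (branchBits-suc-true Y n (trans (cong branches IH) br))
            (≼-≺-trans {X = R} (branchBits-mono Y lt) Y≺R))))
          (trans (cong (R ∘ length) (branchBits-cong Y X n IH))
            (≺-∷ʳ⁻ {branchBits X n} {R} (subst (_≺ R) (branchBits-suc-true X n br) (bits≺R (suc n)))))

  open Computability (χ T?)

  module _ {n : ℕ} {Γ : Ctx n} where

    abstract
      onTreeB : ∀ {S} → Computable Γ str S → Computable Γ bool (λ γ → does (T? (S γ)))
      onTreeB {S} s = ext (λ γ → cong (λ σ → does (T? σ)) (dec-enc (S γ))) (oracle (encN s))

      branchesB : ∀ {S} → Computable Γ str S → Computable Γ bool (branches ∘ S)
      branchesB s = onTreeB (snocS s falseB) ∧B onTreeB (snocS s trueB)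

  abstract
    consumedS : Computable (str ∷ []) str (λ (σ , _) → consumed σ)
    consumedS = ext (λ (σ , _) → lemma (pad σ) (length σ))
      (natrecᶜ (lengthN (var 0F)) nilS
        (ifᶜ (branchesB (pad-↾S (var 2F) (var 0F))) (snocS (var 1F) (padB (var 2F) (var 0F))) (var 1F)))
      where
      lemma : ∀ X n → natrec [] (λ j y → if branches (X ↾ j) then y ∷ʳ X j else y) n ≡ branchBits X n
      lemma X zero    = refl
      lemma X (suc n) = cong (λ y → if branches (X ↾ n) then y ∷ʳ X n else y) (lemma X n)

-- Classical minima and the values of complexity

module _ (em : ExcludedMiddle 0ℓ) where

  least-witness : (Q : Pred ℕ 0ℓ) → ∀ {n} → Q n → ∃[ k ] (Q k × (∀ j → Q j → k ≤ j))
  least-witness Q {n} q = go n n ≤-refl q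
    where
    go : ∀ b n → n ≤ b → Q n → ∃[ k ] (Q k × (∀ j → Q j → k ≤ j))
    go b n n≤b q with em {∃[ j ] (j < n × Q j)}
    ... | no ¬less = n , q , λ j qj → ≮⇒≥ λ j<n → ¬less (j , j<n , qj)
    go zero    n n≤b q | yes (j , j<n , qj) = contradiction (<-≤-trans j<n n≤b) λ ()
    go (suc b) n n≤b q | yes (j , j<n , qj) = go b j (≤-pred (<-≤-trans j<n n≤b)) qj

  -- A shortest program supplies the value of `K` at which the bound is applied; every other program
  -- is at least as long.
  K-bound : ∀ A U σ c {l} → (∀ k → K[ A , U ] σ ≡ k → l ≤ k + c) → ∀ q → A ⊢ U ⟦ q ⟧≡ σ → l ≤ length q + c
  K-bound A U σ c bound q d
    with k , (p , dp , refl) , least ← least-witness (λ k → ∃[ p ] (A ⊢ U ⟦ p ⟧≡ σ × length p ≡ k)) (q , d , refl)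
    = ≤-trans (bound (length p) ((p , dp , refl) , λ p′ d′ → least (length p′) (p′ , d′ , refl)))
        (+-monoˡ-≤ c (least (length q) (q , d , refl)))

  bounded-or-unbounded : (h : ℕ → ℕ) → (∃[ n ] ∀ m → h m ≤ h n) ⊎ (∀ L → ∃[ n ] L ≤ h n)
  bounded-or-unbounded h with em {∃[ n ] ∀ m → h m ≤ h n}
  ... | yes max = inj₁ max
  ... | no ¬max = inj₂ reach
    where
    reach : ∀ L → ∃[ n ] L ≤ h n
    reach zero    = 0 , z≤n
    reach (suc L) with n , le ← reach L with em {∃[ m ] h n < h m}
    ... | yes (m , lt) = m , ≤-trans (s≤s le) lt
    ... | no ¬lt = contradiction (n , λ m → ≮⇒≥ λ lt → ¬lt (m , lt)) ¬max

-- The two directions of the equivalence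

module _ (em : ExcludedMiddle 0ℓ) (P : Pred Seq 0ℓ) (U : Code 1) (opt : Optimal (χ (tree? em P)) U)
  (X : Seq) (X∈P : X ∈ P) where

  private
    T? : Decidable (Tree P)
    T? = tree? em P
    A : Oracle
    A = χ T?

    onTree : ∀ n → Tree P (X ↾ n)
    onTree n = X , X∈P , ↾-≺ X n

    Bound : Set
    Bound = ∃[ c ] ∀ n k → K[ A , U ] (X ↾ n) ≡ k → θ T? (X ↾ n) ≤ k + c

  random⇒bound : RandomlyProduced T? X → Bound
  random⇒bound (R , R-random , ΨR≗X) with em {Bound}
  ... | yes bound = bound
  ... | no ¬bound = contradiction caught (R-random test test-measure)
    where
    open CompressionTest A U (proj₁ opt) (consumed T?) (consumedS T?)
    caught : ∀ c → R ∈⟦ W[ A , test ] c ⟧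
    -- If `R` escaped component `c`, then `c` itself would serve as the constant of `Bound`.
    caught c with em {R ∈⟦ W[ A , test ] c ⟧}
    ... | yes R∈ = R∈
    ... | no  R∉ = contradiction (c , bound) ¬bound
      where
      bound : ∀ n k → K[ A , U ] (X ↾ n) ≡ k → θ T? (X ↾ n) ≤ k + c
      bound n k ((p , d , refl) , _) = ≮⇒≥ λ lt → R∉
        (branchBits T? X n , branchBits-≺ T? X onTree R ΨR≗X n ,
         test-complete c _ (p , X ↾ n , d , consumed-↾ T? X n ,
           <⇒≤ (subst (length p + c <_) (θ-↾ T? X onTree n) lt)))

  -- All branching bits of `X` are spelt out by stage `n`, so any sequence extending them produces
  -- `X`; one of these is random.
  finite⇒random : ∀ n → (∀ m → length (branchBits T? X m) ≤ length (branchBits T? X n)) → RandomlyProduced T? X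
  finite⇒random n max = from-extension (random-extension em opt (branchBits T? X n))
    where
    from-extension : ∃[ R ] (branchBits T? X n ≺ R × MLR A R) → RandomlyProduced T? X
    from-extension (R , ρ≺R , R-random) = R , R-random , Ψ-≗ T? X onTree R λ m →
      ≼-≺-trans {X = R} (branchBits-comparable T? X {m} {n} (max m)) ρ≺R

  module Infinite (c : ℕ) (bound : ∀ n k → K[ A , U ] (X ↾ n) ≡ k → θ T? (X ↾ n) ≤ k + c)
    (reach : ∀ L → ∃[ n ] L ≤ length (branchBits T? X n)) where

    -- The stage given by `reach (suc i)` spells out more than `i` bits, so the default of `pad` is
    -- not met. The bits of different stages are comparable, hence the choice of stage is
    -- immaterial.
    R : Seq
    R i = pad (branchBits T? X (proj₁ (reach (suc i)))) i

    bits≺R : ∀ m → branchBits T? X m ≺ R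
    bits≺R m = pointwise⇒≺ _ R same
      where
      same : ∀ i → i < length (branchBits T? X m) → R i ≡ pad (branchBits T? X m) i
      same i i< with n , i<n ← reach (suc i) with ≤-total (length (branchBits T? X m)) (length (branchBits T? X n))
      ... | inj₁ le = ≼⇒pad (branchBits-comparable T? X {m} {n} le) i<
      ... | inj₂ le = sym (≼⇒pad (branchBits-comparable T? X {n} {m} le) i<n)

    -- Only the branching bits of `σ` are known to lie on `R`. As `σ` is on the tree, `agree` makes
    -- it an initial segment of `X`, where the assumed bound applies.
    incompressible : ∀ σ q → does (T? σ) ≡ true → consumed T? σ ≺ R → A ⊢ U ⟦ q ⟧≡ σ →
                     length (consumed T? σ) ≤ length q + c
    incompressible σ q t σ≺R d = subst (_≤ length q + c) θ≡
      (K-bound em A U (X ↾ n) c (bound n) q (subst (A ⊢ U ⟦ q ⟧≡_) σ≡ d))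
      where
      n = length σ
      σ-onTree : ∀ j → j ≤ n → Tree P (pad σ ↾ j)
      σ-onTree j j≤ with Y , Y∈P , σ≺Y ← decidable-stable (T? σ) (λ ¬t → true≢false t (dec-false (T? σ) ¬t))
        = Y , Y∈P , ≼-≺-trans {X = Y} (subst (pad σ ↾ j ≼_) (≺-pad σ) (↾-mono-≼ (pad σ) j≤)) σ≺Y
      σ≡ : σ ≡ X ↾ n
      σ≡ = trans (sym (≺-pad σ)) (agree T? X onTree R bits≺R (pad σ) n σ-onTree σ≺R n ≤-refl)
      θ≡ : θ T? (X ↾ n) ≡ length (consumed T? σ)
      θ≡ = trans (θ-↾ T? X onTree n) (cong length (trans (sym (consumed-↾ T? X n)) (cong (consumed T?) (sym σ≡))))

    onto : ∀ L → ∃[ σ ] (does (T? σ) ≡ true × consumed T? σ ≡ R ↾ L)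
    onto L with n , le ← reach L with m , refl ← branchBits-reach T? X L n le
      = X ↾ m , dec-true (T? (X ↾ m)) (onTree m) , trans (consumed-↾ T? X m) (sym (bits≺R m))

    R-random : MLR A R
    R-random = incompressible⇒random A opt (consumed T?) (consumedS T?) (does ∘ T?)
      (onTreeB T? (Computability.var A 0F)) R c incompressible onto

  bound⇒random : Bound → RandomlyProduced T? X
  bound⇒random (c , bound) with bounded-or-unbounded em (λ n → length (branchBits T? X n))
  ... | inj₁ (n , max) = finite⇒random n max
  ... | inj₂ reach     = R , R-random , Ψ-≗ T? X onTree R bits≺R
    where open Infinite c bound reach

theorem3p4 : (em : ExcludedMiddle 0ℓ) →
    (P : Pred Seq 0ℓ) → IsΠ⁰₁ P → Satisfiable P →
    let T? = tree? em P
        A  = χ T?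
    in
    (U : Code 1) → Optimal A U →
    (X : Seq) → X ∈ P →
    RandomlyProduced T? X ⇔
      (∃[ c ] ∀ n k → K[ A , U ] (X ↾ n) ≡ k → θ T? (X ↾ n) ≤ k + c)
theorem3p4 em P _ _ U opt X X∈P = mk⇔ (random⇒bound em P U opt X X∈P) (bound⇒random em P U opt X X∈P)
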